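{- The Tool Loading Problem can be solved in time $O(Cn)$: there is an algorithm which, given any instance $(T_1,\dots,T_n;C)$ of the Tool Loading Problem, performs $O(Cn)$ elementary operations (with an absolute implied constant, in particular independent of $m$, $n$, $C$) and outputs a sequence $M^*\in\operatorname{argmin}\{\mathrm{switches}(M): M\in\mathbf{M}\}$.
   Context: Tool Loading Problem (TLP). $T=\{1,\dots,m\}$ is the set of tools and $J=\{1,\dots,n\}$ the set of jobs, processed in the order $1,2,\dots,n$. Job $i$ needs the set of tools $T_i\subseteq T$ (given as a list of integers). The magazine has capacity $C$, a positive integer. Standing assumptions: $\bigcup_{i=1}^n T_i=T$ (so $m=|\bigcup_{i=1}^n T_i|\le Cn$), $|T_i|\le C$ for all $i$, and $C<m$. Let $\mathbf{M}=\{M=(M_1,\dots,M_n): M_i\subseteq T,\ T_i\subseteq M_i,\ |M_i|=C \text{ for all } i\in J\}$ and $\mathrm{switches}(M)=\sum_{i=1}^{n-1}|M_{i+1}\setminus M_i|$. The TLP is the problem of finding an element of $\mathbf{M}$ minimizing $\mathrm{switches}$. Elementary operations are those of the unit-cost random access machine (arithmetic and comparison on integers, and reading/writing of array entries, in particular of arrays indexed by the tools $1,\dots,m$, each at unit cost). -}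

module Defs where

open import Data.Bool using (if_then_else_)
open import Data.Fin using (Fin; toℕ; suc; inject₁)
open import Data.Fin.Subset using (Subset; _∈_; _⊆_; _─_; ∣_∣)
open import Data.Integer as ℤ using (ℤ; +_; -[1+_]; 0ℤ)
open import Data.List using (List; []; _∷_; length; map; concat; tabulate)
import Data.List.Membership.Propositional as List
open import Data.List.Relation.Unary.Unique.Propositional using (Unique)
open import Data.Maybe using (Maybe; just; nothing)
open import Data.Nat using (ℕ; zero; suc; _+_; _*_; _≤_; _<_; _≟_)
open import Data.Nat.Properties using (+-0-commutativeMonoid)
open import Data.Product using (_×_; ∃-syntax)
open import Function using (_⇔_)
open import Relation.Binary.PropositionalEquality using (_≡_)
open import Relation.Nullary using (does)

open import Algebra.Properties.CommutativeMonoid.Sum +-0-commutativeMonoid using (sum)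

------------------------------------------------------------------------
-- The Tool Loading Problem

record Instance : Set where
  field
    m n C    : ℕ
    T        : Fin n → Subset m
    positive : 0 < C
    covers   : ∀ t → ∃[ i ] t ∈ T i
    fits     : ∀ i → ∣ T i ∣ ≤ C
    C<m      : C < m

Loading : Instance → Set
Loading I = Fin n → Subset m
  where open Instance I

Feasible : (I : Instance) → Loading I → Set
Feasible I M = ∀ i → T i ⊆ M i × ∣ M i ∣ ≡ C
  where open Instance I

switches : ∀ {m n} → (Fin n → Subset m) → ℕ
switches {n = zero}  M = 0
switches {n = suc _} M = sum (λ i → ∣ M (suc i) ─ M (inject₁ i) ∣)

Optimal : (I : Instance) → Loading I → Set
Optimal I M = Feasible I M × (∀ M′ → Feasible I M′ → switches M ≤ switches M′)

-- The sets T i reach the algorithm as lists, in an arbitrary order but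
-- without repetitions.
record Listing (I : Instance) : Set where
  open Instance I
  field
    tools  : Fin n → List (Fin m)
    unique : ∀ i → Unique (tools i)
    lists  : ∀ i t → t List.∈ tools i ⇔ t ∈ T i

------------------------------------------------------------------------
-- A unit-cost random access machine over ℤ, with registers and arrays.
-- Both are named by literals in the program, so that a program only ever
-- touches finitely many of each; arrays are unbounded.

Reg Arr Addr : Set
Reg  = ℕ
Arr  = ℕ
Addr = ℕ

data Instr : Set where
  const         : Reg → ℤ → Instr
  move          : Reg → Reg → Instr
  add sub mul   : Reg → Reg → Reg → Instr     -- destination first
  load          : Reg → Arr → Reg → Instr     -- load r a s : r ← a[s]
  store         : Arr → Reg → Reg → Instr     -- store a s r : a[s] ← r
  jump          : Addr → Instr
  jump-if-less  : Reg → Reg → Addr → Instr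
  jump-if-equal : Reg → Reg → Addr → Instr
  halt          : Instr

Program : Set
Program = List Instr

record Config : Set where
  constructor config
  field
    pc  : Addr
    reg : Reg → ℤ
    arr : Arr → ℤ → ℤ

setReg : (Reg → ℤ) → Reg → ℤ → Reg → ℤ
setReg ρ r v s = if does (s ≟ r) then v else ρ s

setArr : (Arr → ℤ → ℤ) → Arr → ℤ → ℤ → Arr → ℤ → ℤ
setArr α a i v b j =
  if does (b ≟ a) then (if does (j ℤ.≟ i) then v else α b j) else α b j

-- Running past the end of the program halts.
fetch : Program → Addr → Instr
fetch []       _       = halt
fetch (x ∷ _)  zero    = x
fetch (_ ∷ xs) (suc p) = fetch xs p

execute : Instr → Config → Maybe Config
execute (const r z)           (config p ρ α) = just (config (suc p) (setReg ρ r z) α)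
execute (move r s)            (config p ρ α) = just (config (suc p) (setReg ρ r (ρ s)) α)
execute (add r s t)           (config p ρ α) = just (config (suc p) (setReg ρ r (ρ s ℤ.+ ρ t)) α)
execute (sub r s t)           (config p ρ α) = just (config (suc p) (setReg ρ r (ρ s ℤ.- ρ t)) α)
execute (mul r s t)           (config p ρ α) = just (config (suc p) (setReg ρ r (ρ s ℤ.* ρ t)) α)
execute (load r a s)          (config p ρ α) = just (config (suc p) (setReg ρ r (α a (ρ s))) α)
execute (store a s r)         (config p ρ α) = just (config (suc p) ρ (setArr α a (ρ s) (ρ r)))
execute (jump q)              (config p ρ α) = just (config q ρ α)
execute (jump-if-less r s q)  (config p ρ α) =
  just (config (if does (ρ r ℤ.<? ρ s) then q else suc p) ρ α)
execute (jump-if-equal r s q) (config p ρ α) =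
  just (config (if does (ρ r ℤ.≟ ρ s) then q else suc p) ρ α)
execute halt                  _              = nothing

step : Program → Config → Maybe Config
step P σ = execute (fetch P (Config.pc σ)) σ

-- P ⊢ σ ⇓[ k ] τ : started in σ, P halts in τ after exactly k steps.
data _⊢_⇓[_]_ (P : Program) : Config → ℕ → Config → Set where
  halted : ∀ {σ} → step P σ ≡ nothing → P ⊢ σ ⇓[ 0 ] σ
  next   : ∀ {σ σ′ τ k} → step P σ ≡ just σ′ → P ⊢ σ′ ⇓[ k ] τ → P ⊢ σ ⇓[ suc k ] τ

------------------------------------------------------------------------
-- Input and output conventions.  Array entries start at index 0; tools are
-- the integers 1 … m.

label : ∀ {m} → Fin m → ℤ
label t = + suc (toℕ t)

contents : List ℤ → ℤ → ℤ
contents []       _         = 0ℤ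
contents (x ∷ _)  (+ zero)  = x
contents (_ ∷ xs) (+ suc i) = contents xs (+ i)
contents (_ ∷ _)  -[1+ _ ]  = 0ℤ

-- Register 0 holds n, register 1 holds C, array 0 the lengths of the n input
-- lists and array 1 their concatenation; everything else is 0.  In
-- particular m is not supplied.
module _ {I : Instance} (L : Listing I) where
  open Instance I
  open Listing L

  initialReg : Reg → ℤ
  initialReg 0 = + n
  initialReg 1 = + C
  initialReg _ = 0ℤ

  initialArr : Arr → ℤ → ℤ
  initialArr 0 = contents (tabulate (λ i → + length (tools i)))
  initialArr 1 = contents (map label (concat (tabulate tools)))
  initialArr _ = λ _ → 0ℤ

  initial : Config
  initial = config 0 initialReg initialArr

-- Array 2 holds an n × C table in row-major order whose i-th row lists
-- exactly the elements of M i.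
Outputs : (I : Instance) → Config → Loading I → Set
Outputs I σ M = ∀ i →
    (∀ (j : Fin C) → ∃[ t ] t ∈ M i × entry i j ≡ label t)
  × (∀ t → t ∈ M i → ∃[ j ] entry i j ≡ label t)
  where
  open Instance I
  entry : Fin n → Fin C → ℤ
  entry i j = Config.arr σ 2 (+ (toℕ i * C + toℕ j))

{-# OPTIONS --safe #-}
module Submission where

-- Put an empty slot 0 before the jobs and call a use of a tool t at job i,
-- together with the slots strictly between the previous use of t and i (all of
-- 0 … i-1 if there is none), a pipe.  Keeping t over its pipe saves one switch.
-- Treat the uses in the order of the jobs and accept a pipe exactly when no
-- slot of it is full yet; since accepted pipes never cross the last full slot,
-- this is a single comparison with the previous use of t.  Every rejection is
-- then charged to the last full slot f: the C tools in slot f and the tools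
-- rejected since are all different and used in f … i, and any loading holds
-- only C of them at f, so it needs that many switches between f and i.  Hence
-- the number of rejections up to i bounds the switches up to i of every
-- loading from below.  Conversely a tool enters a row only when its pipe was
-- rejected, and topping each row up to C tools with tools of the preceding
-- row costs no switch.  Running time: each push onto a row lengthens it, and
-- the n + 1 rows have length at most C.

open import Defs
open import Algebra.Properties.AbelianGroup using (∙-cancelʳ)
open import Data.Bool using (if_then_else_)
open import Data.Empty using (⊥-elim)
open import Data.Fin as Fin using (Fin; toℕ; zero; suc; inject₁)
import Data.Fin.Properties as Fin
open import Data.Fin.Subset as Subset using (Subset; inside; outside; _∈_; _∉_; _─_; _∪_; ∣_∣; ⁅_⁆)
open import Data.Fin.Subset.Properties renaming (_∈?_ to _∈ˢ?_)
open import Data.Integer as ℤ using (ℤ; +_)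
import Data.Integer.Properties as ℤ
open import Data.List using (List; []; _∷_; _++_; length; foldr; concat; map; tabulate)
import Data.List.Membership.DecPropositional as DecMembership
import Data.List.Membership.Propositional as List
open import Data.List.Properties using (length-tabulate; map-tabulate)
open import Data.List.Relation.Unary.All using (lookup)
open import Data.List.Relation.Unary.All.Properties using (¬Any⇒All¬)
open import Data.List.Relation.Unary.AllPairs using ([]; _∷_)
open import Data.List.Relation.Unary.Any using (here; there)
open import Data.List.Relation.Unary.Unique.Propositional using (Unique)
open import Data.List.Relation.Unary.Unique.Propositional.Properties using (allFin⁺; Unique[x∷xs]⇒x∉xs)
open import Data.Maybe using (Maybe; just; nothing)
open import Data.Nat using (ℕ; zero; suc; _+_; _*_; _∸_; _≤_; _<_; z≤n; s≤s; _≟_; _<?_; _≤?_)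
open import Data.Nat.Properties hiding (_≟_; _<?_; _≤?_)
open import Data.Nat.Tactic.RingSolver using (solve-∀)
open import Data.Product using (_×_; _,_; ∃-syntax; proj₁; proj₂)
open import Data.Sum as Sum using (_⊎_; inj₁; inj₂)
open import Data.Unit using (⊤; tt)
import Data.Vec as Vec
open import Function using (_∘_; id; Equivalence)
open import Relation.Binary.Definitions using (DecidableEquality; tri<; tri≈; tri>)
open import Relation.Binary.PropositionalEquality
open import Relation.Nullary using (¬_; Dec; does; yes; no; contradiction)
open import Relation.Nullary.Decidable using (dec-true; dec-false)

open import Algebra.Properties.CommutativeMonoid.Sum +-0-commutativeMonoid using (sum; sum-cong-≗)

-- The charge to `f` rests on one dichotomy. A tool lying in slot `f` has its latest use at `f` or
-- later, whereas a tool is rejected because its latest use lies before the last full slot. Once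
-- rejected it has a later use, so it cannot be counted a second time. Tools rejected after slot
-- `f`, but before `f` filled up, must be counted too. Hence the counting list is maintained for
-- every slot from the last full one on, any of which may be the next to fill.
--
-- Topping up works only if slot 0 ends with `C` tools. While no slot is full, slot 0 collects every
-- tool used so far, and `C < m` with the covering assumption makes some slot fill up eventually.

-- Cardinalities of subsets and lengths of duplicate-free lists

∣p∪q∣≤∣p∣+∣q∣ : ∀ {m} (p q : Subset m) → ∣ p ∪ q ∣ ≤ ∣ p ∣ + ∣ q ∣
∣p∪q∣≤∣p∣+∣q∣ Vec.[]            Vec.[]            = z≤n
∣p∪q∣≤∣p∣+∣q∣ (outside Vec.∷ p) (outside Vec.∷ q) = ∣p∪q∣≤∣p∣+∣q∣ p q
∣p∪q∣≤∣p∣+∣q∣ (inside Vec.∷ p)  (outside Vec.∷ q) = s≤s (∣p∪q∣≤∣p∣+∣q∣ p q)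
∣p∪q∣≤∣p∣+∣q∣ (outside Vec.∷ p) (inside Vec.∷ q)
  rewrite +-suc ∣ p ∣ ∣ q ∣ = s≤s (∣p∪q∣≤∣p∣+∣q∣ p q)
∣p∪q∣≤∣p∣+∣q∣ (inside Vec.∷ p)  (inside Vec.∷ q)
  rewrite +-suc ∣ p ∣ ∣ q ∣ = s≤s (m≤n⇒m≤1+n (∣p∪q∣≤∣p∣+∣q∣ p q))

module _ {m : ℕ} where

  fromList : List (Fin m) → Subset m
  fromList = foldr (λ t p → ⁅ t ⁆ ∪ p) Subset.⊥

  ∈-fromList⁺ : ∀ {t xs} → t List.∈ xs → t ∈ fromList xs
  ∈-fromList⁺ (here {xs = xs} refl) = x∈p∪q⁺ (inj₁ (x∈⁅x⁆ _))
  ∈-fromList⁺ (there {x} t∈xs)      = x∈p∪q⁺ {p = ⁅ x ⁆} (inj₂ (∈-fromList⁺ t∈xs))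

  ∈-fromList⁻ : ∀ {t} xs → t ∈ fromList xs → t List.∈ xs
  ∈-fromList⁻ []       t∈ = ⊥-elim (∉⊥ t∈)
  ∈-fromList⁻ (x ∷ xs) t∈ with x∈p∪q⁻ ⁅ x ⁆ (fromList xs) t∈
  ... | inj₁ t∈x  = here (x∈⁅y⁆⇒x≡y x t∈x)
  ... | inj₂ t∈xs = there (∈-fromList⁻ xs t∈xs)

  ∣fromList∣≤length : ∀ xs → ∣ fromList xs ∣ ≤ length xs
  ∣fromList∣≤length []       = ≤-reflexive (∣⊥∣≡0 m)
  ∣fromList∣≤length (x ∷ xs) = ≤-trans (∣p∪q∣≤∣p∣+∣q∣ ⁅ x ⁆ (fromList xs))
    (+-mono-≤ (≤-reflexive (∣⁅x⁆∣≡1 x)) (∣fromList∣≤length xs))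

  length≤∣∣ : ∀ {xs} {p : Subset m} → Unique xs → (∀ {t} → t List.∈ xs → t ∈ p) →
    length xs ≤ ∣ p ∣
  length≤∣∣ []           _    = z≤n
  length≤∣∣ (x∉xs ∷ xs!) xs⊆p = ≤-trans
    (s≤s (length≤∣∣ xs! λ t∈xs → x∈p∧x≢y⇒x∈p-y (xs⊆p (there t∈xs)) (lookup x∉xs t∈xs ∘ sym)))
    (x∈p⇒∣p-x∣<∣p∣ (xs⊆p (here refl)))

  length-mono : ∀ {xs ys : List (Fin m)} → Unique xs →
    (∀ {t} → t List.∈ xs → t List.∈ ys) → length xs ≤ length ys
  length-mono {ys = ys} xs! xs⊆ys =
    ≤-trans (length≤∣∣ xs! (∈-fromList⁺ ∘ xs⊆ys)) (∣fromList∣≤length ys)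

  ∣∣≤length : ∀ {p : Subset m} xs → (∀ {t} → t ∈ p → t List.∈ xs) → ∣ p ∣ ≤ length xs
  ∣∣≤length xs p⊆xs = ≤-trans (p⊆q⇒∣p∣≤∣q∣ (∈-fromList⁺ ∘ p⊆xs)) (∣fromList∣≤length xs)

  ∣fromList∣≡length : ∀ {xs} → Unique xs → ∣ fromList xs ∣ ≡ length xs
  ∣fromList∣≡length {xs} xs! = ≤-antisym (∣fromList∣≤length xs) (length≤∣∣ xs! ∈-fromList⁺)

  insert-unique : ∀ {t : Fin m} {xs} → t List.∉ xs → Unique xs → Unique (t ∷ xs)
  insert-unique t∉xs xs! = ¬Any⇒All¬ _ t∉xs ∷ xs!

-- Finite sums and pointwise updates

total : (ℕ → ℕ) → ℕ → ℕ
total f zero    = 0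
total f (suc N) = total f N + f N

total-cong : ∀ {f g} N → (∀ {k} → k < N → f k ≡ g k) → total f N ≡ total g N
total-cong zero    f≗g = refl
total-cong (suc N) f≗g = cong₂ _+_ (total-cong N (f≗g ∘ m≤n⇒m≤1+n)) (f≗g ≤-refl)

total-mono : ∀ {f g} N → (∀ k → f k ≤ g k) → total f N ≤ total g N
total-mono zero    f≤g = z≤n
total-mono (suc N) f≤g = +-mono-≤ (total-mono N f≤g) (f≤g N)

total≤ : ∀ {f b} N → (∀ k → f k ≤ b) → total f N ≤ N * b
total≤ {b = b} zero    f≤b = z≤n
total≤ {b = b} (suc N) f≤b =
  ≤-trans (+-mono-≤ (total≤ N f≤b) (f≤b N)) (≤-reflexive (+-comm (N * b) b))

nth : {A : Set} → List (List A) → ℕ → List A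
nth []         _       = []
nth (xs ∷ xss) zero    = xs
nth (xs ∷ xss) (suc k) = nth xss k

module Update {K : Set} (_≈?_ : DecidableEquality K) {A : Set} where

  upd : (K → A) → K → A → K → A
  upd f s v k = if does (k ≈? s) then v else f k

  upd-same : ∀ f s {v} → upd f s v s ≡ v
  upd-same f s rewrite dec-true (s ≈? s) refl = refl

  upd-other : ∀ f {s v k} → k ≢ s → upd f s v k ≡ f k
  upd-other f {s} {k = k} k≢s rewrite dec-false (k ≈? s) k≢s = refl

  upd-elim : ∀ f {s v k} {p} (P : A → Set p) → (k ≡ s → P v) → (k ≢ s → P (f k)) → P (upd f s v k)
  upd-elim f {s} {k = k} P eq neq with k ≈? s
  ... | yes k≡s = eq k≡s
  ... | no  k≢s = neq k≢s

open Update _≟_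
module Tools {m : ℕ} {A : Set} = Update (Fin._≟_ {m}) {A}

-- The greedy rule for pipes

module Greedy {m : ℕ} (C : ℕ) where

  -- Off by one: full is 1 + the last full slot, or 0 if no slot is full.
  record Magazine : Set where
    constructor mag
    field
      row  : ℕ → List (Fin m)
      full : ℕ

  open Magazine public

  -- `full` may simply be overwritten: pushes go only to slots from `full` on, so a slot that fills
  -- up lies after all earlier full ones.
  push : ℕ → Fin m → Magazine → Magazine
  push s t (mag row full) = mag (upd row s (t ∷ row s))
    (if does (suc (length (row s)) <? C) then full else suc s)

  pushes : ℕ → ℕ → Fin m → Magazine → Magazine
  pushes zero    s t μ = μ
  pushes (suc c) s t μ = pushes c (suc s) t (push s t μ)

  pushes-outside : ∀ c s t μ k → k < s ⊎ s + c ≤ k → row (pushes c s t μ) k ≡ row μ k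
  pushes-outside zero    s t μ k out = refl
  pushes-outside (suc c) s t μ k (inj₁ k<s) =
    trans (pushes-outside c (suc s) t _ k (inj₁ (m≤n⇒m≤1+n k<s))) (upd-other (row μ) (<⇒≢ k<s))
  pushes-outside (suc c) s t μ k (inj₂ s+c≤k) rewrite +-suc s c =
    trans (pushes-outside c (suc s) t _ k (inj₂ s+c≤k))
      (upd-other (row μ) (≢-sym (<⇒≢ (≤-trans (s≤s (m≤m+n s c)) s+c≤k))))

  pushes-inside : ∀ c s t μ k → s ≤ k → k < s + c → row (pushes c s t μ) k ≡ t ∷ row μ k
  pushes-inside zero    s t μ k s≤k k<s rewrite +-identityʳ s = contradiction k<s (≤⇒≯ s≤k)
  pushes-inside (suc c) s t μ k s≤k k<s+c rewrite +-suc s c with m≤n⇒m<n∨m≡n s≤k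
  ... | inj₁ s<k  = trans (pushes-inside c (suc s) t _ k s<k k<s+c)
                      (cong (t ∷_) (upd-other (row μ) (≢-sym (<⇒≢ s<k))))
  ... | inj₂ refl = trans (pushes-outside c (suc s) t _ s (inj₁ ≤-refl)) (upd-same (row μ) s)

  size : Magazine → ℕ → ℕ
  size μ s = length (row μ s)

  total-push : ∀ s t μ N → s < N → total (size (push s t μ)) N ≡ suc (total (size μ) N)
  total-push s t μ (suc N) s<1+N with m≤n⇒m<n∨m≡n s<1+N
  ... | inj₁ (s≤s s<N) = cong₂ _+_ (total-push s t μ N s<N)
                           (cong length (upd-other (row μ) (≢-sym (<⇒≢ s<N))))
  ... | inj₂ refl = trans (cong₂ _+_
        (total-cong N λ k<N → cong length (upd-other (row μ) (<⇒≢ k<N)))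
        (cong length (upd-same (row μ) s)))
      (+-suc (total (size μ) N) _)

  total-pushes : ∀ c s t μ N → s + c ≤ N → total (size (pushes c s t μ)) N ≡ c + total (size μ) N
  total-pushes zero    s t μ N _   = refl
  total-pushes (suc c) s t μ N s+c≤N rewrite +-suc s c = trans
    (total-pushes c (suc s) t (push s t μ) N s+c≤N)
    (trans (cong (λ x → c + x) (total-push s t μ N (≤-trans (s≤s (m≤m+n s c)) s+c≤N)))
      (+-suc c _))

  -- The index `s` is the slot to be written next. Since `full` stays at most `s`, consecutive
  -- pushes from `s` on always find room, even if each of them fills its slot.
  record Bounded (μ : Magazine) (s : ℕ) : Set where
    field
      size≤C   : ∀ k → size μ k ≤ C
      full≤    : full μ ≤ s
      roomy    : ∀ {k} → full μ ≤ k → size μ k < C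
      full-at  : ∀ {f} → full μ ≡ suc f → size μ f ≡ C

  open Bounded

  push-bounded : ∀ {μ s} t → Bounded μ s → Bounded (push s t μ) (suc s)
  push-bounded {μ} {s} t B = bounded
    where
    size≤ : ∀ k → length (upd (row μ) s (t ∷ row μ s) k) ≤ C
    size≤ k = upd-elim (row μ) (λ xs → length xs ≤ C) (λ _ → roomy B (full≤ B)) (λ _ → size≤C B k)
    bounded : Bounded (push s t μ) (suc s)
    bounded with suc (size μ s) <? C
    ... | yes fits rewrite dec-true (suc (size μ s) <? C) fits = record
      { size≤C  = size≤
      ; full≤   = m≤n⇒m≤1+n (full≤ B)
      ; roomy   = λ F≤k → upd-elim (row μ) (λ xs → length xs < C) (λ _ → fits) (λ _ → roomy B F≤k)
      ; full-at = λ {f} F≡ → upd-elim (row μ) (λ xs → length xs ≡ C)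
          (λ { refl → contradiction (≤-trans (≤-reflexive (sym F≡)) (full≤ B)) (<-irrefl refl) })
          (λ _ → full-at B F≡)
      }
    ... | no ¬fits rewrite dec-false (suc (size μ s) <? C) ¬fits = record
      { size≤C  = size≤
      ; full≤   = ≤-refl
      ; roomy   = λ s<k → subst (λ xs → length xs < C) (sym (upd-other (row μ) (≢-sym (<⇒≢ s<k))))
          (roomy B (≤-trans (full≤ B) (<⇒≤ s<k)))
      ; full-at = λ { refl → trans (cong length (upd-same (row μ) s))
          (≤-antisym (roomy B (full≤ B)) (≮⇒≥ ¬fits)) }
      }

  push-full≥ : ∀ {μ s} t → full μ ≤ s → full μ ≤ full (push s t μ)
  push-full≥ {μ} {s} t F≤s with suc (size μ s) <? C
  ... | yes fits rewrite dec-true (suc (size μ s) <? C) fits = ≤-refl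
  ... | no ¬fits rewrite dec-false (suc (size μ s) <? C) ¬fits = m≤n⇒m≤1+n F≤s

  pushes-bounded : ∀ c {s} t {μ} → Bounded μ s → Bounded (pushes c s t μ) (s + c)
  pushes-bounded zero    {s} t B rewrite +-identityʳ s = B
  pushes-bounded (suc c) {s} t B rewrite +-suc s c = pushes-bounded c t (push-bounded t B)

  pushes-full≥ : ∀ c {s} t {μ} → Bounded μ s → full μ ≤ full (pushes c s t μ)
  pushes-full≥ zero    t B = ≤-refl
  pushes-full≥ (suc c) t {μ} B =
    ≤-trans (push-full≥ {μ} t (full≤ B)) (pushes-full≥ c t (push-bounded t B))

  -- nxt t is 1 + the slot of the last use of t, or 0 before its first use: the
  -- first slot of the next pipe of t.  The field rejected occurs only in the
  -- analysis, the machine does not store it.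
  record State : Set where
    constructor state
    field
      magazine : Magazine
      nxt      : Fin m → ℕ
      rejected : ℕ → List (Fin m)
    open Magazine magazine public renaming (row to slots; full to barrier)

  open State public using (magazine; nxt; rejected)

  -- The use itself occupies slot `i`, one past the end of its pipe, whence `suc i ∸ s` pushes. With
  -- `s = i` only the use is stored, as after a rejection.
  advance : ℕ → ℕ → (ℕ → List (Fin m)) → Fin m → State → State
  advance i s X t σ = state (pushes (suc i ∸ s) s t (magazine σ)) (Tools.upd (nxt σ) t (suc i)) X

  use : ℕ → Fin m → State → State
  -- The last full slot precedes `i` under the invariant below, so it lies in the pipe exactly when
  -- the pipe starts no later than it. Without a full slot `full` is 0 and the test always fails.
  use i t σ = if does (nxt σ t <? full (magazine σ))
    then advance i i (upd (rejected σ) i (t ∷ rejected σ i)) t σ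
    else advance i (nxt σ t) (rejected σ) t σ

  uses : ℕ → List (Fin m) → State → State
  uses i []       σ = σ
  uses i (t ∷ ts) σ = uses i ts (use i t σ)

  jobs : ℕ → List (List (Fin m)) → State → State
  jobs i []         σ = σ
  jobs i (ts ∷ tss) σ = jobs (suc i) tss (uses (suc i) ts σ)

  -- Switches against rejections

  switchesTo : (ℕ → Subset m) → ℕ → ℕ
  switchesTo S = total (λ s → ∣ S (suc s) ─ S s ∣)

  -- Shifted by one to match `switchesTo`: the transition numbered `s` leads into slot `suc s`.
  rejections : (ℕ → List (Fin m)) → ℕ → ℕ
  rejections X = total (λ s → length (X (suc s)))

  rejections-before : ∀ X {i xs} g → g < i → rejections (upd X i xs) g ≡ rejections X g
  rejections-before X {i} g g<i = total-cong g λ k<g →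
    cong length (upd-other X (<⇒≢ (≤-trans (s≤s k<g) g<i)))

  rejections-at : ∀ X i t →
    rejections (upd X (suc i) (t ∷ X (suc i))) (suc i) ≡ suc (rejections X (suc i))
  rejections-at X i t = trans
    (cong₂ _+_ (rejections-before X i ≤-refl) (cong length (upd-same X (suc i))))
    (+-suc (rejections X i) _)

  module Window (S : ℕ → Subset m) (f : ℕ) where

    -- This is the union of the sets in slots `f` to `d + f`, assembled from newcomers only so that
    -- each transition enlarges it by at most its switches.
    seen : ℕ → Subset m
    seen zero    = S f
    seen (suc d) = seen d ∪ (S (suc (d + f)) ─ S (d + f))

    S⊆seen : ∀ d e → e ≤ d → ∀ {t} → t ∈ S (e + f) → t ∈ seen d
    S⊆seen zero    zero    _  t∈ = t∈
    S⊆seen (suc d) e       e≤ {t} t∈ with m≤n⇒m<n∨m≡n e≤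
    ... | inj₁ (s≤s e≤d) = x∈p∪q⁺ (inj₁ (S⊆seen d e e≤d t∈))
    ... | inj₂ refl with t ∈ˢ? S (d + f)
    ...   | yes t∈S = x∈p∪q⁺ (inj₁ (S⊆seen d d ≤-refl t∈S))
    ...   | no  t∉S = x∈p∪q⁺ {p = seen d} (inj₂ (x∈p∧x∉q⇒x∈p─q t∈ t∉S))

    ∣seen∣ : ∀ d → ∣ seen d ∣ + switchesTo S f ≤ ∣ S f ∣ + switchesTo S (d + f)
    ∣seen∣ zero    = ≤-refl
    ∣seen∣ (suc d) = begin
      ∣ seen d ∪ D ∣ + switchesTo S f         ≤⟨ +-monoˡ-≤ _ (∣p∪q∣≤∣p∣+∣q∣ (seen d) D) ⟩
      ∣ seen d ∣ + ∣ D ∣ + switchesTo S f     ≡⟨ +-assoc (∣ seen d ∣) _ _ ⟩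
      ∣ seen d ∣ + (∣ D ∣ + switchesTo S f)   ≡⟨ cong (λ x → ∣ seen d ∣ + x) (+-comm (∣ D ∣) _) ⟩
      ∣ seen d ∣ + (switchesTo S f + ∣ D ∣)   ≡⟨ +-assoc (∣ seen d ∣) _ _ ⟨
      ∣ seen d ∣ + switchesTo S f + ∣ D ∣     ≤⟨ +-monoˡ-≤ _ (∣seen∣ d) ⟩
      ∣ S f ∣ + switchesTo S (d + f) + ∣ D ∣  ≡⟨ +-assoc (∣ S f ∣) _ _ ⟩
      ∣ S f ∣ + switchesTo S (suc d + f)      ∎
      where
      open ≤-Reasoning
      D = S (suc (d + f)) ─ S (d + f)

  -- The invariant of the greedy rule and the lower bound

  module Analysis (need : ℕ → List (Fin m)) where

    -- Asking for at most `C` tools rather than exactly `C` lets a loading be continued by empty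
    -- sets past the last job.
    LowerBound : ℕ → ℕ → Set
    LowerBound g r = ∀ S → (∀ s → ∣ S s ∣ ≤ C) → (∀ s {t} → t List.∈ need s → t ∈ S s) →
      r ≤ switchesTo S g

    -- All of `W` is seen between `f` and `i`, but slot `f` holds at most `C` tools. The others cost
    -- a switch each after `f`, on top of the `r` switches already forced up to `f`.
    lower-bound-window : ∀ {f i r r′ W} → f ≤ i → LowerBound f r → Unique W →
      (∀ {t} → t List.∈ W → ∃[ k ] f ≤ k × k ≤ i × t List.∈ need k) →
      r′ + C ≤ r + length W → LowerBound i r′
    lower-bound-window {f} {i} {r} {r′} {W} f≤i low W! W⊆ r′+C≤ S S≤C need⊆S =
      subst (λ j → r′ ≤ switchesTo S j) (m∸n+n≡m f≤i)
        (+-cancelʳ-≤ (C + switchesTo S f) r′ _ (begin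
          r′ + (C + switchesTo S f)              ≡⟨ +-assoc r′ C _ ⟨
          r′ + C + switchesTo S f                ≤⟨ +-monoˡ-≤ _ r′+C≤ ⟩
          r + length W + switchesTo S f          ≡⟨ +-assoc r (length W) _ ⟩
          r + (length W + switchesTo S f)
            ≤⟨ +-mono-≤ (low S S≤C need⊆S) (+-monoˡ-≤ _ (length≤∣∣ W! W⊆seen)) ⟩
          switchesTo S f + (∣ seen d ∣ + switchesTo S f)
            ≤⟨ +-monoʳ-≤ (switchesTo S f) (∣seen∣ d) ⟩
          switchesTo S f + (∣ S f ∣ + switchesTo S (d + f))
            ≤⟨ +-monoʳ-≤ (switchesTo S f) (+-monoˡ-≤ _ (S≤C f)) ⟩
          switchesTo S f + (C + switchesTo S (d + f))
            ≡⟨ rearrange (switchesTo S f) C (switchesTo S (d + f)) ⟩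
          switchesTo S (d + f) + (C + switchesTo S f)  ∎))
      where
      open ≤-Reasoning
      open Window S f
      d = i ∸ f
      rearrange : ∀ a b c → a + (b + c) ≡ c + (b + a)
      rearrange = solve-∀
      W⊆seen : ∀ {t} → t List.∈ W → t ∈ seen d
      W⊆seen t∈W with k , f≤k , k≤i , t∈k ← W⊆ t∈W =
        S⊆seen d (k ∸ f) (∸-monoˡ-≤ f k≤i)
          (subst (λ j → _ ∈ S j) (sym (m∸n+n≡m f≤k)) (need⊆S k t∈k))

    -- For a full slot k the window shows that the C tools of slot k and the
    -- rejections after k are matched by different tools used from k on.
    record WindowAt (i : ℕ) (σ : State) (k : ℕ) : Set where
      constructor windowAt
      field
        {window}  : List (Fin m)
        unique    : Unique window
        used-from : ∀ {t} → t List.∈ window → k < nxt σ t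
        counted   : rejections (rejected σ) i + size (magazine σ) k ≤
                    rejections (rejected σ) k + length window

    record Invariant (i : ℕ) (todo : List (Fin m)) (σ : State) : Set where
      open State σ using (slots; barrier)
      field
        bounded     : Bounded (magazine σ) (suc i)
        -- Reserves room in slot `i` for the rest of the job, so that slot `i` cannot be full while
        -- a tool is left.
        capacity    : length (slots i) + length todo ≤ C
        todo-unique : Unique todo
        todo-needed : ∀ {t} → t List.∈ todo → t List.∈ need i
        todo-fresh  : ∀ {t} → t List.∈ todo → nxt σ t ≤ i
        nxt≤        : ∀ t → nxt σ t ≤ suc i
        row-unique  : ∀ k → Unique (slots k)
        row<nxt     : ∀ {k t} → t List.∈ slots k → k < nxt σ t
        last-row    : ∀ {k t} → nxt σ t ≡ suc k → t List.∈ slots k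
        last-needed : ∀ {k t} → nxt σ t ≡ suc k → t List.∈ need k
        covered     : ∀ {k t} → t List.∈ need k → k ≤ i → t List.∈ slots k ⊎ (k ≡ i × t List.∈ todo)
        kept        : ∀ {k t} → t List.∈ slots (suc k) → t List.∈ slots k ⊎ t List.∈ rejected σ (suc k)
        row₀-all    : barrier ≡ 0 → ∀ {t} → 0 < nxt σ t → t List.∈ slots 0
        row₀-full   : 0 < barrier → length (slots 0) ≡ C
        untouched   : ∀ {k} → i < k → rejected σ k ≡ []
        -- Starts at the last full slot itself, whose number is one below `barrier`; later slots
        -- need a window ready for when they fill up.
        windows     : ∀ {k} → barrier ≤ suc k → k ≤ i → WindowAt i σ k
        lower       : ∀ {g} → g ≤ i → LowerBound g (rejections (rejected σ) g)

      todo-roomy : 0 < length todo → barrier ≤ i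
      todo-roomy 0<todo with m≤n⇒m<n∨m≡n (full≤ bounded)
      ... | inj₁ (s≤s F≤i) = F≤i
      ... | inj₂ F≡1+i     = contradiction
        (≤-trans (+-monoʳ-≤ (length (slots i)) 0<todo) capacity)
        (<⇒≱ (≤-reflexive (trans (cong suc (sym (full-at bounded F≡1+i))) (+-comm 1 _))))

    -- Shared by both outcomes of a use: `s` is `nxt σ t` for an accepted pipe and `i` for a
    -- rejected one. What depends on the outcome enters as arguments of `advance-invariant`.
    module Advance {i t ts σ s} (inv : Invariant i (t ∷ ts) σ) (X : ℕ → List (Fin m))
      (nxt≤s : nxt σ t ≤ s) (s≤i : s ≤ i) (full≤s : full (magazine σ) ≤ s) where

      open State σ using (slots; barrier)
      open Invariant inv

      σ′ : State
      σ′ = advance i s X t σ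

      open State σ′ using () renaming (slots to row′; barrier to full′)

      s+c≡1+i : s + (suc i ∸ s) ≡ suc i
      s+c≡1+i = m+[n∸m]≡n (m≤n⇒m≤1+n s≤i)

      row-inside : ∀ {k} → s ≤ k → k ≤ i → row′ k ≡ t ∷ slots k
      row-inside s≤k k≤i = pushes-inside (suc i ∸ s) s t (magazine σ) _ s≤k
        (≤-trans (s≤s k≤i) (≤-reflexive (sym s+c≡1+i)))

      row-before : ∀ {k} → k < s → row′ k ≡ slots k
      row-before k<s = pushes-outside (suc i ∸ s) s t (magazine σ) _ (inj₁ k<s)

      row-after : ∀ {k} → i < k → row′ k ≡ slots k
      row-after i<k = pushes-outside (suc i ∸ s) s t (magazine σ) _
        (inj₂ (≤-trans (≤-reflexive s+c≡1+i) i<k))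

      row-elim : ∀ k {p} (P : List (Fin m) → Set p) →
        (s ≤ k → k ≤ i → P (t ∷ slots k)) → P (slots k) → P (row′ k)
      row-elim k P hit miss with s ≤? k | k ≤? i
      ... | yes s≤k | yes k≤i = subst P (sym (row-inside s≤k k≤i)) (hit s≤k k≤i)
      ... | no  s≰k | _       = subst P (sym (row-before (≰⇒> s≰k))) miss
      ... | yes _   | no  k≰i = subst P (sym (row-after (≰⇒> k≰i))) miss

      row⊆row′ : ∀ {k u} → u List.∈ slots k → u List.∈ row′ k
      row⊆row′ {k} u∈ = row-elim k (_ List.∈_) (λ _ _ → there u∈) u∈

      row′⁻ : ∀ {k u} → u List.∈ row′ k → u List.∈ slots k ⊎ (u ≡ t × s ≤ k × k ≤ i)
      row′⁻ {k} {u} = row-elim k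
        (λ xs → u List.∈ xs → u List.∈ slots k ⊎ (u ≡ t × s ≤ k × k ≤ i))
        (λ { s≤k k≤i (here u≡t) → inj₂ (u≡t , s≤k , k≤i)
           ; _ _ (there u∈) → inj₁ u∈ })
        inj₁

      t∈row′ : ∀ {k} → s ≤ k → k ≤ i → t List.∈ row′ k
      t∈row′ s≤k k≤i = subst (t List.∈_) (sym (row-inside s≤k k≤i)) (here refl)

      size-row′≤ : ∀ k → length (row′ k) ≤ suc (length (slots k))
      size-row′≤ k = row-elim k (λ xs → length xs ≤ suc (length (slots k)))
        (λ _ _ → ≤-refl) (n≤1+n _)

      bounded-s : Bounded (magazine σ) s
      bounded-s = record { Bounded bounded ; full≤ = full≤s }

      bounded′ : Bounded (magazine σ′) (suc i)
      bounded′ = subst (Bounded (magazine σ′)) s+c≡1+i (pushes-bounded (suc i ∸ s) t bounded-s)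

      full≤full′ : barrier ≤ full′
      full≤full′ = pushes-full≥ (suc i ∸ s) t bounded-s

      nxt-elim : ∀ u (P : ℕ → Set) → (u ≡ t → P (suc i)) → (u ≢ t → P (nxt σ u)) → P (nxt σ′ u)
      nxt-elim u = Tools.upd-elim (nxt σ)

      nxt≤nxt′ : ∀ u → nxt σ u ≤ nxt σ′ u
      nxt≤nxt′ u = nxt-elim u (nxt σ u ≤_) (λ _ → nxt≤ u) (λ _ → ≤-refl)

      row-unique′ : ∀ k → Unique (row′ k)
      row-unique′ k = row-elim k Unique
        (λ s≤k _ → insert-unique (λ t∈ → <⇒≱ (row<nxt t∈) (≤-trans nxt≤s s≤k)) (row-unique k))
        (row-unique k)

      row<nxt′ : ∀ {k u} → u List.∈ row′ k → k < nxt σ′ u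
      row<nxt′ {k} {u} u∈ with row′⁻ u∈
      ... | inj₁ u∈row = ≤-trans (row<nxt u∈row) (nxt≤nxt′ u)
      ... | inj₂ (u≡t , _ , k≤i) = nxt-elim u (k <_) (λ _ → s≤s k≤i) (contradiction u≡t)

      last-row′ : ∀ {k u} → nxt σ′ u ≡ suc k → u List.∈ row′ k
      last-row′ {k} {u} = nxt-elim u (λ x → x ≡ suc k → u List.∈ row′ k)
        (λ { refl refl → t∈row′ s≤i ≤-refl })
        (λ _ eq → row⊆row′ (last-row eq))

      last-needed′ : ∀ {k u} → nxt σ′ u ≡ suc k → u List.∈ need k
      last-needed′ {k} {u} = nxt-elim u (λ x → x ≡ suc k → u List.∈ need k)
        (λ { refl refl → todo-needed (here refl) })
        (λ _ → last-needed)

      -- An accepted pipe starts at slot 0 or right after the last use of `t`, where `t` lies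
      -- already by `last-row`. Only a rejected use can bring `t` in afresh, and then it is recorded
      -- in `X`.
      kept′ : s ≡ nxt σ t ⊎ (s ≡ i × t List.∈ X i) →
        (∀ {k u} → u List.∈ rejected σ k → u List.∈ X k) →
        ∀ {k u} → u List.∈ row′ (suc k) → u List.∈ row′ k ⊎ u List.∈ X (suc k)
      kept′ why X⊇ {k} u∈ with row′⁻ u∈
      ... | inj₁ u∈row with kept u∈row
      ...   | inj₁ u∈k = inj₁ (row⊆row′ u∈k)
      ...   | inj₂ u∈X = inj₂ (X⊇ u∈X)
      kept′ why X⊇ {k} u∈ | inj₂ (refl , s≤1+k , 1+k≤i) with m≤n⇒m<n∨m≡n s≤1+k | why
      ... | inj₁ (s≤s s≤k) | _                    = inj₁ (t∈row′ s≤k (<⇒≤ 1+k≤i))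
      ... | inj₂ refl      | inj₁ s≡nxt           = inj₁ (row⊆row′ (last-row (sym s≡nxt)))
      ... | inj₂ refl      | inj₂ (refl , t∈X)    = inj₂ t∈X

      row₀-all′ : (barrier ≡ 0 → s ≡ nxt σ t) → barrier ≡ 0 → ∀ {u} → 0 < nxt σ′ u → u List.∈ row′ 0
      row₀-all′ accept F≡0 {u} = nxt-elim u (λ x → 0 < x → u List.∈ row′ 0)
        (λ { refl _ → first (nxt σ t) refl })
        (λ _ 0<nxt → row⊆row′ (row₀-all F≡0 0<nxt))
        where
        first : ∀ x → nxt σ t ≡ x → t List.∈ row′ 0
        first zero    nxt≡ = t∈row′ (≤-reflexive (trans (accept F≡0) nxt≡)) z≤n
        first (suc x) nxt≡ = row⊆row′ (row₀-all F≡0 (≤-trans (s≤s z≤n) (≤-reflexive (sym nxt≡))))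

      -- Before the first full slot nothing is rejected, so row 0 contains every
      -- tool used so far and fills up together with that slot.
      row₀-full′ : (barrier ≡ 0 → s ≡ nxt σ t) → 0 < full′ → length (row′ 0) ≡ C
      row₀-full′ accept 0<F′ = ≤-antisym (size≤C bounded′ 0) (go barrier refl full′ refl)
        where
        go : ∀ F → barrier ≡ F → ∀ F′ → full′ ≡ F′ → C ≤ length (row′ 0)
        go _       _   zero    F′≡ = contradiction F′≡ (>⇒≢ 0<F′)
        go zero    F≡0 (suc f) F′≡ = ≤-trans (≤-reflexive (sym (full-at bounded′ F′≡)))
          (length-mono (row-unique′ f) λ u∈ →
            row₀-all′ accept F≡0 (≤-trans (s≤s z≤n) (row<nxt′ u∈)))
        go (suc F) F≡ _ _ = ≤-trans (≤-reflexive (sym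
          (row₀-full (≤-trans (s≤s z≤n) (≤-reflexive (sym F≡))))))
          (length-mono (row-unique 0) row⊆row′)

      -- Members of a window have `nxt` beyond `k`, so `nxt σ t ≤ k` makes `t` new; after this use
      -- it meets the same condition.
      extend : ∀ {k} → nxt σ t ≤ k → k ≤ i → (w : WindowAt i σ k) →
        Unique (t ∷ WindowAt.window w) ×
        (∀ {u} → u List.∈ t ∷ WindowAt.window w → k < nxt σ′ u)
      extend {k} nxt≤k k≤i (windowAt W! used _) =
        insert-unique (λ t∈W → <⇒≱ (used t∈W) nxt≤k) W! ,
        λ { (here refl)     → nxt-elim t (k <_) (λ _ → s≤s k≤i) (contradiction refl)
          ; {u} (there u∈W) → ≤-trans (used u∈W) (nxt≤nxt′ u) }

      advance-invariant : (barrier ≡ 0 → s ≡ nxt σ t) →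
        s ≡ nxt σ t ⊎ (s ≡ i × t List.∈ X i) →
        (∀ {k u} → u List.∈ rejected σ k → u List.∈ X k) →
        (∀ {k} → i < k → X k ≡ []) →
        (∀ {k} → barrier ≤ suc k → k ≤ i → WindowAt i σ′ k) →
        (∀ {g} → g ≤ i → LowerBound g (rejections X g)) →
        Invariant i ts σ′
      advance-invariant accept why X⊇ untouched′ windows′ lower′ = record
        { bounded     = bounded′
        ; capacity    = begin
            length (row′ i) + length ts        ≤⟨ +-monoˡ-≤ _ (size-row′≤ i) ⟩
            suc (length (slots i) + length ts)   ≡⟨ +-suc _ _ ⟨
            length (slots i) + length (t ∷ ts)   ≤⟨ capacity ⟩
            C                                  ∎
        ; todo-unique = tail-unique todo-unique
        ; todo-needed = todo-needed ∘ there
        ; todo-fresh  = λ {u} u∈ts → nxt-elim u (_≤ i)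
            (λ { refl → contradiction u∈ts (Unique[x∷xs]⇒x∉xs todo-unique) })
            (λ _ → todo-fresh (there u∈ts))
        ; nxt≤        = λ u → nxt-elim u (_≤ suc i) (λ _ → ≤-refl) (λ _ → nxt≤ u)
        ; row-unique  = row-unique′
        ; row<nxt     = row<nxt′
        ; last-row    = last-row′
        ; last-needed = last-needed′
        ; covered     = covered′
        ; kept        = kept′ why X⊇
        ; row₀-all    = λ F′≡0 → row₀-all′ accept (n≤0⇒n≡0 (≤-trans full≤full′ (≤-reflexive F′≡0)))
        ; row₀-full   = row₀-full′ accept
        ; untouched   = untouched′
        ; windows     = λ F′≤ → windows′ (≤-trans full≤full′ F′≤)
        ; lower       = lower′
        }
        where
        open ≤-Reasoning
        tail-unique : Unique (t ∷ ts) → Unique ts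
        tail-unique (_ ∷ ts!) = ts!
        covered′ : ∀ {k u} → u List.∈ need k → k ≤ i → u List.∈ row′ k ⊎ (k ≡ i × u List.∈ ts)
        covered′ u∈ k≤i with covered u∈ k≤i
        ... | inj₁ u∈row              = inj₁ (row⊆row′ u∈row)
        ... | inj₂ (refl , here refl) = inj₁ (t∈row′ s≤i ≤-refl)
        ... | inj₂ (refl , there u∈)  = inj₂ (refl , u∈)

    -- Rejection counts stay fixed. If the pipe reaches back to `k`, slot `k` and its window both
    -- gain `t`; otherwise neither changes.
    accept-invariant : ∀ {i t ts σ} → Invariant i (t ∷ ts) σ → full (magazine σ) ≤ nxt σ t →
      Invariant i ts (advance i (nxt σ t) (rejected σ) t σ)
    accept-invariant {i} {t} {ts} {σ} inv full≤nxt =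
      advance-invariant (λ _ → refl) (inj₁ refl) id untouched windows′ lower
      where
      open Invariant inv
      open Advance inv (rejected σ) ≤-refl (todo-fresh (here refl)) full≤nxt
      open State σ using (slots)
      open State σ′ using () renaming (slots to row′)
      R = rejections (rejected σ)
      windows′ : ∀ {k} → full (magazine σ) ≤ suc k → k ≤ i → WindowAt i σ′ k
      windows′ {k} F≤ k≤i with windows F≤ k≤i | nxt σ t ≤? k
      ... | w@(windowAt {W} _ _ count) | yes nxt≤k =
        windowAt (proj₁ (extend nxt≤k k≤i w)) (proj₂ (extend nxt≤k k≤i w)) (begin
          R i + length (row′ k)      ≤⟨ +-monoʳ-≤ (R i) (size-row′≤ k) ⟩
          R i + suc (length (slots k)) ≡⟨ +-suc (R i) _ ⟩
          suc (R i + length (slots k)) ≤⟨ s≤s count ⟩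
          suc (R k + length W)       ≡⟨ +-suc (R k) _ ⟨
          R k + suc (length W)       ∎)
        where open ≤-Reasoning
      ... | windowAt W! used count | no nxt≰k =
        windowAt W! (λ {u} u∈ → ≤-trans (used u∈) (nxt≤nxt′ u))
          (subst (λ xs → R i + length xs ≤ _) (sym (row-before (≰⇒> nxt≰k))) count)

    -- Every window concerned starts at or after the last full slot, hence after the last use of
    -- `t`, and gains `t` to pay for the new rejection. The window of the last full slot, where the
    -- size is `C`, then gives the new lower bound.
    reject-invariant : ∀ {h t ts σ} → let i = suc h in
      Invariant i (t ∷ ts) σ → nxt σ t < full (magazine σ) →
      Invariant i ts (advance i i (upd (rejected σ) i (t ∷ rejected σ i)) t σ)
    reject-invariant {h} {t} {ts} {σ} inv nxt<full =
      advance-invariant (λ F≡0 → contradiction (subst (nxt σ t <_) F≡0 nxt<full) λ())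
        (inj₂ (refl , subst (t List.∈_) (sym (upd-same X i)) (here refl)))
        (λ {k} {u} u∈ → upd-elim X (u List.∈_) (λ { refl → there u∈ }) (λ _ → u∈))
        (λ {k} i<k → trans (upd-other X (>⇒≢ i<k)) (untouched i<k))
        windows′ lower′
      where
      i = suc h
      X = rejected σ
      X′ = upd X i (t ∷ X i)
      F = full (magazine σ)
      R  = rejections X
      R′ = rejections X′
      open Invariant inv
      F≤i : F ≤ i
      F≤i = todo-roomy (s≤s z≤n)
      open Advance inv X′ (todo-fresh (here refl)) ≤-refl F≤i
      open State σ using (slots)
      open State σ′ using () renaming (slots to row′)
      open ≤-Reasoning
      windows′ : ∀ {k} → F ≤ suc k → k ≤ i → WindowAt i σ′ k
      windows′ {k} F≤ k≤i with windows F≤ k≤i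
      ... | w@(windowAt {W} _ _ count) = windowAt (proj₁ ext) (proj₂ ext) count′
        where
        ext = extend (≤-pred (≤-trans nxt<full F≤)) k≤i w
        count′ : R′ i + length (row′ k) ≤ R′ k + suc (length W)
        count′ with m≤n⇒m<n∨m≡n k≤i
        ... | inj₁ k<i = begin
          R′ i + length (row′ k)     ≡⟨ cong₂ (λ r xs → r + length xs) (rejections-at X h t) (row-before k<i) ⟩
          suc (R i + length (slots k)) ≤⟨ s≤s count ⟩
          suc (R k + length W)       ≡⟨ +-suc (R k) _ ⟨
          R k + suc (length W)       ≡⟨ cong (_+ suc (length W)) (rejections-before X k k<i) ⟨
          R′ k + suc (length W)      ∎
        -- No rejection lies after slot `i` itself, so here `t` pays for the growth of slot `i`
        -- instead.
        ... | inj₂ refl = +-monoʳ-≤ (R′ i)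
          (≤-trans (size-row′≤ i) (s≤s (+-cancelˡ-≤ (R i) _ _ count)))
      lower′ : ∀ {g} → g ≤ i → LowerBound g (R′ g)
      lower′ {g} g≤i with m≤n⇒m<n∨m≡n g≤i
      ... | inj₁ g<i  = subst (LowerBound g) (sym (rejections-before X g g<i)) (lower g≤i)
      ... | inj₂ refl = go F refl
        where
        go : ∀ x → F ≡ x → LowerBound i (R′ i)
        go zero    F≡ = contradiction (subst (nxt σ t <_) F≡ nxt<full) λ()
        go (suc f) F≡ = lower-bound-window f≤i (lower f≤i) (proj₁ ext) used (begin
          R′ i + C                   ≡⟨ cong₂ _+_ (rejections-at X h t) (sym (full-at bounded F≡)) ⟩
          suc (R i + length (slots f)) ≤⟨ s≤s (WindowAt.counted w) ⟩
          suc (R f + length (WindowAt.window w)) ≡⟨ +-suc (R f) _ ⟨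
          R f + suc (length (WindowAt.window w)) ∎)
          where
          f≤i : f ≤ i
          f≤i = ≤-trans (n≤1+n f) (≤-trans (≤-reflexive (sym F≡)) F≤i)
          w = windows (≤-reflexive F≡) f≤i
          ext = extend (≤-pred (≤-trans nxt<full (≤-reflexive F≡))) f≤i w
          used : ∀ {u} → u List.∈ t ∷ WindowAt.window w →
            ∃[ k ] f ≤ k × k ≤ i × u List.∈ need k
          used (here refl) = i , f≤i , ≤-refl , todo-needed (here refl)
          used {u} (there u∈) = last (nxt σ u) refl (WindowAt.used-from w u∈)
            where
            last : ∀ x → nxt σ u ≡ x → f < x → ∃[ k ] f ≤ k × k ≤ i × u List.∈ need k
            last (suc k) nxt≡ (s≤s f≤k) =
              k , f≤k , ≤-pred (≤-trans (≤-reflexive (sym nxt≡)) (nxt≤ u)) , last-needed nxt≡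

    use-invariant : ∀ {h t ts σ} → Invariant (suc h) (t ∷ ts) σ → Invariant (suc h) ts (use (suc h) t σ)
    use-invariant {h} {t} {ts} {σ} inv with nxt σ t <? full (magazine σ)
    ... | yes nxt<F rewrite dec-true (nxt σ t <? full (magazine σ)) nxt<F = reject-invariant inv nxt<F
    ... | no  nxt≮F rewrite dec-false (nxt σ t <? full (magazine σ)) nxt≮F = accept-invariant inv (≮⇒≥ nxt≮F)

    uses-invariant : ∀ {h} ts {σ} → Invariant (suc h) ts σ → Invariant (suc h) [] (uses (suc h) ts σ)
    uses-invariant []       inv = inv
    uses-invariant (t ∷ ts) inv = uses-invariant ts (use-invariant inv)

    empty : ∀ xs → (∀ {t : Fin m} → t List.∉ xs) → xs ≡ []
    empty []       _  = refl
    empty (x ∷ xs) ∉x = contradiction (here refl) ∉x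

    -- Slot `suc i` is still empty and without rejections, so the empty window serves it, and one
    -- more transition cannot lower the number of switches.
    next-invariant : ∀ {i σ} → Unique (need (suc i)) → length (need (suc i)) ≤ C →
      Invariant i [] σ → Invariant (suc i) (need (suc i)) σ
    next-invariant {i} {σ} need! need≤C inv = record
      { bounded     = record { Bounded bounded ; full≤ = m≤n⇒m≤1+n (full≤ bounded) }
      ; capacity    = subst (λ xs → length xs + length (need (suc i)) ≤ C) (sym row≡[]) need≤C
      ; todo-unique = need!
      ; todo-needed = id
      ; todo-fresh  = λ _ → nxt≤ _
      ; nxt≤        = λ t → m≤n⇒m≤1+n (nxt≤ t)
      ; row-unique  = row-unique
      ; row<nxt     = row<nxt
      ; last-row    = last-row
      ; last-needed = last-needed
      ; covered     = covered′
      ; kept        = kept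
      ; row₀-all    = row₀-all
      ; row₀-full   = row₀-full
      ; untouched   = λ 1+i<k → untouched (<⇒≤ 1+i<k)
      ; windows     = windows′
      ; lower       = lower′
      }
      where
      open Invariant inv
      open State σ using (slots)
      R = rejections (rejected σ)
      row≡[] : slots (suc i) ≡ []
      row≡[] = empty _ λ t∈ → <⇒≱ (row<nxt t∈) (nxt≤ _)
      R-same : R (suc i) ≡ R i
      R-same = trans (cong (λ xs → R i + length xs) (untouched ≤-refl)) (+-identityʳ (R i))
      covered′ : ∀ {k t} → t List.∈ need k → k ≤ suc i → t List.∈ slots k ⊎ (k ≡ suc i × t List.∈ need (suc i))
      covered′ t∈ k≤1+i with m≤n⇒m<n∨m≡n k≤1+i
      ... | inj₂ refl = inj₂ (refl , t∈)
      ... | inj₁ (s≤s k≤i) with covered t∈ k≤i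
      ...   | inj₁ t∈row = inj₁ t∈row
      ...   | inj₂ (_ , ())
      windows′ : ∀ {k} → full (magazine σ) ≤ suc k → k ≤ suc i → WindowAt (suc i) σ k
      windows′ {k} F≤ k≤1+i with m≤n⇒m<n∨m≡n k≤1+i
      ... | inj₂ refl = windowAt [] (λ ()) (subst (λ xs → R (suc i) + length xs ≤ R (suc i) + 0) (sym row≡[]) ≤-refl)
      ... | inj₁ (s≤s k≤i) with windows F≤ k≤i
      ...   | windowAt W! used count =
        windowAt W! used (subst (λ r → r + length (slots k) ≤ _) (sym R-same) count)
      lower′ : ∀ {g} → g ≤ suc i → LowerBound g (R g)
      lower′ {g} g≤1+i with m≤n⇒m<n∨m≡n g≤1+i
      ... | inj₁ (s≤s g≤i) = lower g≤i
      ... | inj₂ refl      = λ S S≤C need⊆S →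
        ≤-trans (≤-reflexive R-same)
          (≤-trans (lower ≤-refl S S≤C need⊆S) (m≤m+n (switchesTo S i) _))

    jobs-invariant : (∀ k → Unique (need k)) → (∀ k → length (need k) ≤ C) →
      ∀ i tss {σ : State} → (∀ k → nth tss k ≡ need (suc (k + i))) →
      Invariant i [] σ → Invariant (length tss + i) [] (jobs i tss σ)
    jobs-invariant need! need≤C i []         tss≡ inv = inv
    jobs-invariant need! need≤C i (ts ∷ tss) {σ} tss≡ inv =
      subst (λ j → Invariant j [] (jobs i (ts ∷ tss) σ)) (+-suc (length tss) i)
        (jobs-invariant need! need≤C (suc i) tss
          (λ k → trans (tss≡ (suc k)) (cong (need ∘ suc) (sym (+-suc k i))))
          (uses-invariant ts (subst (λ xs → Invariant (suc i) xs σ) (sym (tss≡ 0))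
            (next-invariant (need! (suc i)) (need≤C (suc i)) inv))))

    start : State
    start = state (mag (λ _ → []) 0) (λ _ → 0) (λ _ → [])

    start-invariant : 0 < C → need 0 ≡ [] → Invariant 0 [] start
    start-invariant 0<C need₀ = record
      { bounded     = record
        { size≤C = λ _ → z≤n ; full≤ = z≤n ; roomy = λ _ → 0<C ; full-at = λ () }
      ; capacity    = z≤n
      ; todo-unique = []
      ; todo-needed = λ ()
      ; todo-fresh  = λ ()
      ; nxt≤        = λ _ → z≤n
      ; row-unique  = λ _ → []
      ; row<nxt     = λ ()
      ; last-row    = λ ()
      ; last-needed = λ ()
      ; covered     = λ { {t = t} t∈ z≤n → contradiction (subst (t List.∈_) need₀ t∈) λ() }
      ; kept        = λ ()
      ; row₀-all    = λ _ ()
      ; row₀-full   = λ ()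
      ; untouched   = λ _ → refl
      ; windows     = λ { _ z≤n → windowAt [] (λ ()) z≤n }
      ; lower       = λ { z≤n _ _ _ → z≤n }
      }

-- From families over `Fin n` to sequences of slots

∈─⇒∉ : ∀ {m} {x : Fin m} {p q} → x ∈ p ─ q → x ∉ q
∈─⇒∉ {p = _ Vec.∷ _} {outside Vec.∷ _} (Vec.there x∈) (Vec.there x∈q) = ∈─⇒∉ x∈ x∈q
∈─⇒∉ {p = _ Vec.∷ _} {inside Vec.∷ _}  (Vec.there x∈) (Vec.there x∈q) = ∈─⇒∉ x∈ x∈q

total-shift : ∀ f N → total f (suc N) ≡ f 0 + total (f ∘ suc) N
total-shift f zero    = +-comm 0 (f 0)
total-shift f (suc N) = trans (cong (_+ f (suc N)) (total-shift f N)) (+-assoc (f 0) _ _)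

sum≡total : ∀ f n → sum {n} (f ∘ toℕ) ≡ total f n
sum≡total f zero    = refl
sum≡total f (suc n) = trans (cong (λ x → f 0 + x) (sum≡total (f ∘ suc) n)) (sym (total-shift f n))

module _ {A : Set} where

  extend : ∀ {n} → A → (Fin n → A) → ℕ → A
  extend {zero}  d f k       = d
  extend {suc n} d f zero    = f zero
  extend {suc n} d f (suc k) = extend d (f ∘ suc) k

  extend-toℕ : ∀ {n} d (f : Fin n → A) i → extend d f (toℕ i) ≡ f i
  extend-toℕ d f zero    = refl
  extend-toℕ d f (suc i) = extend-toℕ d (f ∘ suc) i

  extend-elim : ∀ {n} d (f : Fin n → A) {p} (P : ℕ → A → Set p) →
    (∀ k → P k d) → (∀ i → P (toℕ i) (f i)) → ∀ k → P k (extend d f k)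
  extend-elim {zero}  d f P Pd Pf k       = Pd k
  extend-elim {suc n} d f P Pd Pf zero    = Pf zero
  extend-elim {suc n} d f P Pd Pf (suc k) = extend-elim d (f ∘ suc) (P ∘ suc) (Pd ∘ suc) (Pf ∘ suc) k

nth-tabulate : ∀ {A : Set} {n} (f : Fin n → List A) k → nth (tabulate f) k ≡ extend [] f k
nth-tabulate {n = zero}  f k       = refl
nth-tabulate {n = suc n} f zero    = refl
nth-tabulate {n = suc n} f (suc k) = nth-tabulate (f ∘ suc) k

-- Topping up rows from their predecessors

module Filling {m : ℕ} (C : ℕ) where

  open DecMembership (Fin._≟_ {m}) using (_∈?_)

  insert : Fin m → List (Fin m) → List (Fin m)
  insert t cur = if does (length cur ≟ C) then cur else (if does (t ∈? cur) then cur else t ∷ cur)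

  fillFrom : List (Fin m) → List (Fin m) → List (Fin m)
  fillFrom []       cur = cur
  fillFrom (t ∷ ts) cur = fillFrom ts (insert t cur)

  record Filled (src cur res : List (Fin m)) : Set where
    field
      short  : length res ≤ C
      unique : Unique res
      above  : ∀ {t} → t List.∈ cur → t List.∈ res
      below  : ∀ {t} → t List.∈ res → t List.∈ src ⊎ t List.∈ cur
      filled : length res ≡ C ⊎ (∀ {t} → t List.∈ src → t List.∈ res)

  insert-filled : ∀ t {cur} → Unique cur → length cur ≤ C → Filled (t ∷ []) cur (insert t cur)
  insert-filled t {cur} cur! cur≤C with length cur ≟ C
  ... | yes cur≡C rewrite dec-true (length cur ≟ C) cur≡C = record
    { short = cur≤C ; unique = cur! ; above = id ; below = inj₂ ; filled = inj₁ cur≡C }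
  ... | no  cur≢C rewrite dec-false (length cur ≟ C) cur≢C with t ∈? cur
  ...   | yes t∈cur = record
    { short = cur≤C ; unique = cur! ; above = id ; below = inj₂
    ; filled = inj₂ λ { (here refl) → t∈cur } }
  ...   | no  t∉cur = record
    { short = ≤∧≢⇒< cur≤C cur≢C ; unique = insert-unique t∉cur cur! ; above = there
    ; below = λ { (here refl) → inj₁ (here refl) ; (there u∈) → inj₂ u∈ }
    ; filled = inj₂ λ { (here refl) → here refl } }

  fillFrom-filled : ∀ src {cur} → Unique cur → length cur ≤ C → Filled src cur (fillFrom src cur)
  fillFrom-filled []       cur! cur≤C = record
    { short = cur≤C ; unique = cur! ; above = id ; below = inj₂ ; filled = inj₂ λ () }
  fillFrom-filled (t ∷ ts) {cur} cur! cur≤C = record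
    { short  = short
    ; unique = unique
    ; above  = above ∘ Filled.above one
    ; below  = below′
    ; filled = filled′ (Filled.filled one)
    }
    where
    one = insert-filled t cur! cur≤C
    open Filled (fillFrom-filled ts (Filled.unique one) (Filled.short one))
    below′ : ∀ {u} → u List.∈ fillFrom ts (insert t cur) → u List.∈ t ∷ ts ⊎ u List.∈ cur
    below′ u∈ with below u∈
    ... | inj₁ u∈ts = inj₁ (there u∈ts)
    ... | inj₂ u∈ins with Filled.below one u∈ins
    ...   | inj₁ (here refl) = inj₁ (here refl)
    ...   | inj₂ u∈cur       = inj₂ u∈cur
    res = fillFrom ts (insert t cur)
    filled′ : length (insert t cur) ≡ C ⊎ (∀ {u} → u List.∈ t ∷ [] → u List.∈ insert t cur) →
      length res ≡ C ⊎ (∀ {u} → u List.∈ t ∷ ts → u List.∈ res)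
    filled′ (inj₁ len≡C) = inj₁ (≤-antisym short
      (≤-trans (≤-reflexive (sym len≡C)) (length-mono (Filled.unique one) above)))
    filled′ (inj₂ t∈) = Sum.map id
      (λ ts⊆ → λ { (here refl) → above (t∈ (here refl)) ; (there u∈) → ts⊆ u∈ }) filled

  filledRow : (ℕ → List (Fin m)) → ℕ → List (Fin m)
  filledRow row zero    = row 0
  filledRow row (suc s) = fillFrom (filledRow row s) (row (suc s))

  module _ {row : ℕ → List (Fin m)} (row! : ∀ k → Unique (row k))
    (row≤C : ∀ k → length (row k) ≤ C) (row₀≡C : length (row 0) ≡ C) where

    step-filled : ∀ s → Filled (filledRow row s) (row (suc s)) (filledRow row (suc s))
    step-filled s = fillFrom-filled (filledRow row s) (row! (suc s)) (row≤C (suc s))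

    filledRow-unique : ∀ s → Unique (filledRow row s)
    filledRow-unique zero    = row! 0
    filledRow-unique (suc s) = Filled.unique (step-filled s)

    -- Topping up ends with a full row or with the whole preceding row absorbed; that row has `C`
    -- tools by induction, so both ends give `C`.
    filledRow-length : ∀ s → length (filledRow row s) ≡ C
    filledRow-length zero    = row₀≡C
    filledRow-length (suc s) with Filled.filled (step-filled s)
    ... | inj₁ len≡C = len≡C
    ... | inj₂ src⊆  = ≤-antisym (Filled.short (step-filled s))
      (≤-trans (≤-reflexive (sym (filledRow-length s))) (length-mono (filledRow-unique s) src⊆))

    row⊆filledRow : ∀ s {t} → t List.∈ row s → t List.∈ filledRow row s
    row⊆filledRow zero    = id
    row⊆filledRow (suc s) = Filled.above (step-filled s)

-- Switches with and without slot 0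

∣p─p∣≡0 : ∀ {m} (p : Subset m) → ∣ p ─ p ∣ ≡ 0
∣p─p∣≡0 Vec.[]            = refl
∣p─p∣≡0 (outside Vec.∷ p) = ∣p─p∣≡0 p
∣p─p∣≡0 (inside Vec.∷ p)  = ∣p─p∣≡0 p

switches-slots : ∀ {m n} (S : ℕ → Subset m) (M : Fin (suc n) → Subset m) →
  (∀ i → S (suc (toℕ i)) ≡ M i) →
  ∣ S 1 ─ S 0 ∣ + switches M ≡ total (λ s → ∣ S (suc s) ─ S s ∣) (suc n)
switches-slots {n = n} S M S≡M = sym (trans (total-shift (λ s → ∣ S (suc s) ─ S s ∣) n)
  (cong (λ x → ∣ S 1 ─ S 0 ∣ + x) (sym (trans
    (sum-cong-≗ λ i → sym (cong₂ (λ p q → ∣ p ─ q ∣) (S≡M (suc i))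
      (trans (cong (S ∘ suc) (sym (Fin.toℕ-inject₁ i))) (S≡M (inject₁ i)))))
    (sum≡total (λ s → ∣ S (suc (suc s)) ─ S (suc s) ∣) n)))))

switches≤switchesTo : ∀ {m n} (S : ℕ → Subset m) (M : Fin n → Subset m) →
  (∀ i → S (suc (toℕ i)) ≡ M i) → switches M ≤ total (λ s → ∣ S (suc s) ─ S s ∣) n
switches≤switchesTo {n = zero}  S M S≡M = z≤n
switches≤switchesTo {n = suc n} S M S≡M =
  ≤-trans (m≤n+m (switches M) ∣ S 1 ─ S 0 ∣) (≤-reflexive (switches-slots S M S≡M))

switchesTo≤switches : ∀ {m n} (S : ℕ → Subset m) (M : Fin n → Subset m) →
  (∀ i → S (suc (toℕ i)) ≡ M i) → S 1 ≡ S 0 → total (λ s → ∣ S (suc s) ─ S s ∣) n ≤ switches M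
switchesTo≤switches {n = zero}  S M S≡M S₁≡S₀ = z≤n
switchesTo≤switches {n = suc n} S M S≡M S₁≡S₀ = ≤-reflexive (trans (sym (switches-slots S M S≡M))
  (cong (_+ switches M) (trans (cong (λ p → ∣ p ─ S 0 ∣) S₁≡S₀) (∣p─p∣≡0 (S 0)))))

-- Optimality of the greedy loading

module Optimality (I : Instance) (L : Listing I) where
  open Instance I
  open Listing L
  open Greedy {m} C
  open Filling {m} C

  need : ℕ → List (Fin m)
  need zero    = []
  need (suc k) = extend [] tools k

  open Analysis need

  need-unique : ∀ k → Unique (need k)
  need-unique zero    = []
  need-unique (suc k) = extend-elim [] tools (λ _ → Unique) (λ _ → []) unique k

  ∈-tools⁺ : ∀ {i t} → t ∈ T i → t List.∈ tools i
  ∈-tools⁺ {i} {t} = Equivalence.from (lists i t)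

  ∈-tools⁻ : ∀ {i t} → t List.∈ tools i → t ∈ T i
  ∈-tools⁻ {i} {t} = Equivalence.to (lists i t)

  need≤C : ∀ k → length (need k) ≤ C
  need≤C zero    = z≤n
  need≤C (suc k) = extend-elim [] tools (λ _ ts → length ts ≤ C) (λ _ → z≤n)
    (λ i → ≤-trans (length≤∣∣ (unique i) ∈-tools⁻) (fits i)) k

  need-tools : ∀ i → need (suc (toℕ i)) ≡ tools i
  need-tools = extend-toℕ [] tools

  σ* : State
  σ* = jobs 0 (tabulate tools) start

  σ*-invariant : Invariant n [] σ*
  σ*-invariant = subst (λ j → Invariant j [] σ*)
    (trans (+-identityʳ _) (length-tabulate tools))
    (jobs-invariant need-unique need≤C 0 (tabulate tools)
      (λ k → trans (nth-tabulate tools k) (cong (need ∘ suc) (sym (+-identityʳ k))))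
      (start-invariant positive refl))

  open Invariant σ*-invariant
  open State σ* using (slots; barrier)

  used : ∀ {i t} → t ∈ T i → t List.∈ slots (suc (toℕ i))
  used {i} t∈ with covered (subst (_ List.∈_) (sym (need-tools i)) (∈-tools⁺ t∈)) (Fin.toℕ<n i)
  ... | inj₁ t∈slot = t∈slot
  ... | inj₂ (_ , ())

  -- A final barrier of 0 would put all `m` tools, each used by some job, into slot 0, which has
  -- room for only `C < m`.
  slot₀≡C : length (slots 0) ≡ C
  slot₀≡C = go barrier refl
    where
    go : ∀ F → barrier ≡ F → length (slots 0) ≡ C
    go (suc F) F≡ = row₀-full (≤-trans (s≤s z≤n) (≤-reflexive (sym F≡)))
    go zero    F≡ = contradiction (≤-trans
      (≤-trans (≤-reflexive (sym (length-tabulate {n = m} id)))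
        (length-mono (allFin⁺ m) λ {t} _ →
          row₀-all F≡ (≤-trans (s≤s z≤n) (row<nxt (used (proj₂ (covers t)))))))
      (Bounded.size≤C bounded 0)) (<⇒≱ C<m)

  result : ℕ → List (Fin m)
  result = filledRow slots

  result-unique : ∀ s → Unique (result s)
  result-unique = filledRow-unique row-unique (Bounded.size≤C bounded) slot₀≡C

  result-length : ∀ s → length (result s) ≡ C
  result-length = filledRow-length row-unique (Bounded.size≤C bounded) slot₀≡C

  slots⊆result : ∀ s {t} → t List.∈ slots s → t List.∈ result s
  slots⊆result = row⊆filledRow row-unique (Bounded.size≤C bounded) slot₀≡C

  loading : Loading I
  loading i = fromList (result (suc (toℕ i)))

  loading-feasible : Feasible I loading
  loading-feasible i =
    (λ t∈ → ∈-fromList⁺ (slots⊆result _ (used t∈))) ,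
    trans (∣fromList∣≡length (result-unique (suc (toℕ i)))) (result-length (suc (toℕ i)))

  result-kept : ∀ s {t} → t List.∈ result (suc s) →
    t List.∈ result s ⊎ t List.∈ rejected σ* (suc s)
  result-kept s t∈ with Filled.below (step-filled row-unique (Bounded.size≤C bounded) slot₀≡C s) t∈
  ... | inj₁ t∈s    = inj₁ t∈s
  ... | inj₂ t∈slot = Sum.map₁ (slots⊆result s) (kept t∈slot)

  rejected-switches : ∀ s →
    ∣ fromList (result (suc s)) ─ fromList (result s) ∣ ≤ length (rejected σ* (suc s))
  rejected-switches s = ∣∣≤length (rejected σ* (suc s)) switched
    where
    p = fromList (result (suc s))
    q = fromList (result s)
    switched : ∀ {t} → t ∈ p ─ q → t List.∈ rejected σ* (suc s)
    switched t∈ with result-kept s (∈-fromList⁻ (result (suc s)) (p─q⊆p p q t∈))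
    ... | inj₁ t∈s = contradiction (∈-fromList⁺ t∈s) (∈─⇒∉ {p = p} {q} t∈)
    ... | inj₂ t∈X = t∈X

  loading-optimal : Optimal I loading
  loading-optimal = loading-feasible , λ M′ feasible′ → begin
    switches loading                           ≤⟨ switches≤switchesTo (fromList ∘ result) loading (λ _ → refl) ⟩
    switchesTo (fromList ∘ result) n           ≤⟨ total-mono n rejected-switches ⟩
    rejections (rejected σ*) n
      ≤⟨ lower ≤-refl (slotted M′) (slotted≤C feasible′) (need⊆slotted feasible′) ⟩
    switchesTo (slotted M′) n                  ≤⟨ switchesTo≤switches (slotted M′) M′ (extend-toℕ Subset.⊥ M′) refl ⟩
    switches M′                                ∎
    where
    open ≤-Reasoning
    -- Slot 0 repeats the first row of the competitor, so the added transition costs it nothing.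
    slotted : Loading I → ℕ → Subset m
    slotted M′ zero    = extend Subset.⊥ M′ 0
    slotted M′ (suc k) = extend Subset.⊥ M′ k

    extend≤C : ∀ {M′} → Feasible I M′ → ∀ k → ∣ extend Subset.⊥ M′ k ∣ ≤ C
    extend≤C {M′} feasible′ = extend-elim Subset.⊥ M′ (λ _ p → ∣ p ∣ ≤ C)
      (λ _ → ≤-trans (≤-reflexive (∣⊥∣≡0 m)) z≤n)
      (λ i → ≤-reflexive (proj₂ (feasible′ i)))

    slotted≤C : ∀ {M′} → Feasible I M′ → ∀ s → ∣ slotted M′ s ∣ ≤ C
    slotted≤C feasible′ zero    = extend≤C feasible′ 0
    slotted≤C feasible′ (suc k) = extend≤C feasible′ k

    need⊆slotted : ∀ {M′} → Feasible I M′ → ∀ s {t} → t List.∈ need s → t ∈ slotted M′ s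
    need⊆slotted           feasible′ zero    ()
    need⊆slotted {M′} feasible′ (suc k) {t} =
      extend-elim [] tools (λ k ts → t List.∈ ts → t ∈ extend Subset.⊥ M′ k) (λ _ ())
        (λ i t∈ → subst (t ∈_) (sym (extend-toℕ Subset.⊥ M′ i)) (proj₁ (feasible′ i) (∈-tools⁻ t∈))) k

-- Registers: 2 and 13 hold 1 and 0, 3 the current slot, 4 the input position,
-- 5 the field full, 6 a tool, 7 the slot written to, 8 its size, 9 addresses,
-- 10 loop counters, 12 a mark.  Arrays: 3 holds nxt, 4 the sizes of the rows,
-- and 5 marks the members of the row being filled by its slot number.
-- Loop heads: jobs 1, tools 4, pushes 12; rows 27, marking 31, filling 40.
program : Program
program =
    const 2 (+ 1)
  ∷ jump-if-equal 3 0 26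
  ∷ load 10 0 3
  ∷ add 3 3 2
  ∷ jump-if-equal 10 13 1
  ∷ sub 10 10 2
  ∷ load 6 1 4
  ∷ add 4 4 2
  ∷ load 7 3 6
  ∷ jump-if-less 7 5 11
  ∷ jump 12
  ∷ move 7 3
  ∷ jump-if-less 3 7 24
  ∷ load 8 4 7
  ∷ mul 9 7 1
  ∷ add 9 9 8
  ∷ sub 9 9 1
  ∷ store 2 9 6
  ∷ add 8 8 2
  ∷ store 4 7 8
  ∷ add 7 7 2
  ∷ jump-if-less 8 1 12
  ∷ move 5 7
  ∷ jump 12
  ∷ store 3 6 7
  ∷ jump 4
  ∷ const 3 (+ 0)
  ∷ jump-if-equal 3 0 59
  ∷ add 7 3 2
  ∷ load 8 4 7
  ∷ move 10 8
  ∷ jump-if-equal 10 13 39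
  ∷ sub 10 10 2
  ∷ mul 9 7 1
  ∷ add 9 9 10
  ∷ sub 9 9 1
  ∷ load 6 2 9
  ∷ store 5 6 7
  ∷ jump 31
  ∷ move 10 1
  ∷ jump-if-equal 10 13 57
  ∷ sub 10 10 2
  ∷ jump-if-equal 8 1 40
  ∷ mul 9 3 1
  ∷ add 9 9 10
  ∷ sub 9 9 1
  ∷ load 6 2 9
  ∷ load 12 5 6
  ∷ jump-if-equal 12 7 40
  ∷ store 5 6 7
  ∷ mul 9 7 1
  ∷ add 9 9 8
  ∷ sub 9 9 1
  ∷ store 2 9 6
  ∷ add 8 8 2
  ∷ store 4 7 8
  ∷ jump 40
  ∷ move 3 7
  ∷ jump 27
  ∷ []

-- Runs of the program and their cost

-- Evaluates by computation, so any stretch of code without a conditional jump is verified by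
-- `refl`.
iterate : ℕ → Config → Maybe Config
iterate zero    σ = just σ
iterate (suc k) σ with step program σ
... | just σ′ = iterate k σ′
... | nothing = nothing

iterate-+ : ∀ j {k σ τ υ} → iterate j σ ≡ just τ → iterate k τ ≡ just υ → iterate (j + k) σ ≡ just υ
iterate-+ zero    refl run′ = run′
iterate-+ (suc j) {σ = σ} run run′ with step program σ
... | just _ = iterate-+ j run run′

iterate-⇓ : ∀ k {σ τ} → iterate k σ ≡ just τ → step program τ ≡ nothing → program ⊢ σ ⇓[ k ] τ
iterate-⇓ zero    refl stop = halted stop
iterate-⇓ (suc k) {σ} run stop with step program σ in eq
... | just _ = next eq (iterate-⇓ k run stop)

-- a and b are readings of a clock before and after the run, so that bounds
-- compose without sums and may include a potential.
record Reaches (σ : Config) (a b : ℕ) (Q : Config → Set) : Set where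
  constructor reaches
  field
    {steps} : ℕ
    {final} : Config
    clock   : steps + a ≤ b
    run     : iterate steps σ ≡ just final
    post    : Q final

stop : ∀ {σ a Q} → Q σ → Reaches σ a a Q
stop q = reaches ≤-refl refl q

infixr 1 _⟫_
_⟫_ : ∀ {σ a b c Q R} → Reaches σ a b Q → (∀ {τ} → Q τ → Reaches τ b c R) → Reaches σ a c R
_⟫_ {a = a} (reaches {k} clock run post) rest with rest post
... | reaches {l} clock′ run′ post′ = reaches
  (≤-trans (≤-reflexive (trans (cong (_+ a) (+-comm k l)) (+-assoc l k a)))
    (≤-trans (+-monoʳ-≤ l clock) clock′))
  (iterate-+ k run run′) post′

block : ∀ k {σ τ a b Q} → iterate k σ ≡ just τ → Reaches τ (k + a) b Q → Reaches σ a b Q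
block k {a = a} run (reaches {l} clock run′ post) = reaches
  (≤-trans (≤-reflexive (trans (cong (_+ a) (+-comm k l)) (+-assoc l k a))) clock)
  (iterate-+ k run run′) post

relax : ∀ {σ a a′ b b′ Q} → a ≤ a′ → b′ ≤ b → Reaches σ a′ b′ Q → Reaches σ a b Q
relax a≤a′ b′≤b (reaches {k} clock run post) =
  reaches (≤-trans (+-monoʳ-≤ k a≤a′) (≤-trans clock b′≤b)) run post

module _ {pc : Addr} {r s : Reg} {q : Addr} {ρ : Reg → ℤ} {α : Arr → ℤ → ℤ}
  {x y a b : ℕ} {Q : Config → Set} where

  -- Conditional jumps block evaluation because they compare unknown register contents. These four
  -- lemmas decide them through natural numbers known to be equal to the registers.
  less-taken : fetch program pc ≡ jump-if-less r s q → ρ r ≡ + x → ρ s ≡ + y → x < y →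
    Reaches (config q ρ α) (suc a) b Q → Reaches (config pc ρ α) a b Q
  less-taken eq r≡ s≡ p = block 1 run
    where
    run : iterate 1 (config pc ρ α) ≡ just (config q ρ α)
    run rewrite eq | r≡ | s≡ | dec-true (x <? y) p = refl

  less-skipped : fetch program pc ≡ jump-if-less r s q → ρ r ≡ + x → ρ s ≡ + y → ¬ x < y →
    Reaches (config (suc pc) ρ α) (suc a) b Q → Reaches (config pc ρ α) a b Q
  less-skipped eq r≡ s≡ p = block 1 run
    where
    run : iterate 1 (config pc ρ α) ≡ just (config (suc pc) ρ α)
    run rewrite eq | r≡ | s≡ | dec-false (x <? y) p = refl

  equal-taken : fetch program pc ≡ jump-if-equal r s q → ρ r ≡ + x → ρ s ≡ + y → x ≡ y →
    Reaches (config q ρ α) (suc a) b Q → Reaches (config pc ρ α) a b Q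
  equal-taken eq r≡ s≡ p = block 1 run
    where
    run : iterate 1 (config pc ρ α) ≡ just (config q ρ α)
    run rewrite eq | r≡ | s≡ | dec-true (x ≟ y) p = refl

  equal-skipped : fetch program pc ≡ jump-if-equal r s q → ρ r ≡ + x → ρ s ≡ + y → x ≢ y →
    Reaches (config (suc pc) ρ α) (suc a) b Q → Reaches (config pc ρ α) a b Q
  equal-skipped eq r≡ s≡ p = block 1 run
    where
    run : iterate 1 (config pc ρ α) ≡ just (config (suc pc) ρ α)
    run rewrite eq | r≡ | s≡ | dec-false (x ≟ y) p = refl

increment : ∀ {x y a} → x ≡ + a → y ≡ + 1 → x ℤ.+ y ≡ + suc a
increment {a = a} refl refl = cong +_ (+-comm a 1)

decrement : ∀ {x y a} → x ≡ + suc a → y ≡ + 1 → x ℤ.- y ≡ + a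
decrement refl refl = refl

module _ {α : Arr → ℤ → ℤ} {a : Arr} {i v : ℤ} where

  setArr-same : ∀ {j} → j ≡ i → setArr α a i v a j ≡ v
  setArr-same {j} j≡i rewrite dec-true (a ≟ a) refl | dec-true (j ℤ.≟ i) j≡i = refl

  setArr-entry : ∀ {j} → j ≢ i → setArr α a i v a j ≡ α a j
  setArr-entry {j} j≢i rewrite dec-true (a ≟ a) refl | dec-false (j ℤ.≟ i) j≢i = refl

label-injective : ∀ {m} {t u : Fin m} → label t ≡ label u → t ≡ u
label-injective = Fin.toℕ-injective ∘ suc-injective ∘ ℤ.+-injective

-- The machine carries out the greedy rule and the topping up

module Simulation (I : Instance) (L : Listing I) where
  open Instance I
  open Listing L
  open Greedy {m} C
  open Filling {m} C
  open Optimality I L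
  open Analysis need
  open DecMembership (Fin._≟_ {m}) using (_∈?_)

  -- Slot 0 lies at the negative addresses.
  address : ℕ → ℕ → ℤ
  address s k = (+ s ℤ.* + C ℤ.+ + k) ℤ.- + C

  address-cell : ∀ {s k s′ k′} → address s k ≡ address s′ k′ → s * C + k ≡ s′ * C + k′
  address-cell {s} {k} {s′} {k′} eq = ℤ.+-injective (begin
    + (s * C) ℤ.+ + k       ≡⟨ cong (ℤ._+ + k) (ℤ.pos-* s C) ⟩
    + s ℤ.* + C ℤ.+ + k     ≡⟨ ∙-cancelʳ ℤ.+-0-abelianGroup (ℤ.- + C) _ _ eq ⟩
    + s′ ℤ.* + C ℤ.+ + k′   ≡⟨ cong (ℤ._+ + k′) (ℤ.pos-* s′ C) ⟨
    + (s′ * C) ℤ.+ + k′     ∎)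
    where open ≡-Reasoning

  address-suc : ∀ s k → address (suc s) k ≡ + (s * C + k)
  address-suc s k = begin
    (+ suc s ℤ.* + C ℤ.+ + k) ℤ.- + C  ≡⟨ cong (λ x → (x ℤ.+ + k) ℤ.- + C) (ℤ.pos-* (suc s) C) ⟨
    + (C + s * C + k) ℤ.- + C          ≡⟨ cong (λ x → + x ℤ.- + C) (+-assoc C (s * C) k) ⟩
    + (C + (s * C + k)) ℤ.- + C        ≡⟨ ℤ.m-n≡m⊖n (C + (s * C + k)) C ⟩
    (C + (s * C + k)) ℤ.⊖ C            ≡⟨ cong (ℤ._⊖ C) (+-comm C _) ⟩
    (s * C + k + C) ℤ.⊖ C              ≡⟨ ℤ.⊖-≥ (m≤n+m C _) ⟩
    + (s * C + k + C ∸ C)              ≡⟨ cong +_ (m+n∸n≡m (s * C + k) C) ⟩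
    + (s * C + k)                      ∎
    where open ≡-Reasoning

  cell-row≮ : ∀ {s k s′ k′} → k < C → s * C + k ≡ s′ * C + k′ → ¬ s < s′
  cell-row≮ {s} {k} {s′} {k′} k<C eq s<s′ = <-irrefl eq (begin-strict
    s * C + k     <⟨ +-monoʳ-< (s * C) k<C ⟩
    s * C + C     ≡⟨ +-comm (s * C) C ⟩
    suc s * C     ≤⟨ *-monoˡ-≤ C s<s′ ⟩
    s′ * C        ≤⟨ m≤m+n (s′ * C) k′ ⟩
    s′ * C + k′   ∎)
    where open ≤-Reasoning

  -- Uniqueness of the quotient by `C` for remainders below `C`: different rows never share a cell.
  address-row : ∀ {s k s′ k′} → k < C → k′ < C → address s k ≡ address s′ k′ → s ≡ s′
  address-row {s} {k} {s′} {k′} k<C k′<C eq with <-cmp s s′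
  ... | tri< s<s′ _ _ = contradiction s<s′ (cell-row≮ {s} {k} {s′} {k′} k<C (address-cell {s} {k} {s′} {k′} eq))
  ... | tri≈ _ s≡s′ _ = s≡s′
  ... | tri> _ _ s′<s = contradiction s′<s
    (cell-row≮ {s′} {k′} {s} {k} k′<C (sym (address-cell {s} {k} {s′} {k′} eq)))

  address-column : ∀ {s k k′} → address s k ≡ address s k′ → k ≡ k′
  address-column {s} {k} {k′} eq = +-cancelˡ-≡ (s * C) k k′ (address-cell {s} {k} {s} {k′} eq)

  Tool : Set
  Tool = Fin m

  Arrays : Set
  Arrays = Arr → ℤ → ℤ

  -- A row is kept with its latest entry first, so the column of an entry is
  -- the length of the list behind it.
  Stored : Arrays → ℕ → List Tool → Set
  Stored α s []       = ⊤
  Stored α s (t ∷ ts) = α 2 (address s (length ts)) ≡ label t × Stored α s ts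

  stored-cong : ∀ {α α′ s} ts → (∀ {k} → k < length ts → α′ 2 (address s k) ≡ α 2 (address s k)) →
    Stored α s ts → Stored α′ s ts
  stored-cong []       _   _               = tt
  stored-cong (t ∷ ts) α′≡ (entry , stored) =
    trans (α′≡ ≤-refl) entry , stored-cong ts (λ k< → α′≡ (m≤n⇒m≤1+n k<)) stored

  stored-entry : ∀ {α s} ts → Stored α s ts → ∀ {k} → k < length ts →
    ∃[ t ] t List.∈ ts × α 2 (address s k) ≡ label t
  stored-entry (t ∷ ts) (entry , stored) k< with m≤n⇒m<n∨m≡n k<
  ... | inj₂ refl     = t , here refl , entry
  ... | inj₁ (s≤s k<ts) with u , u∈ , eq ← stored-entry ts stored k<ts = u , there u∈ , eq

  stored-column : ∀ {α s} ts → Stored α s ts → ∀ {t} → t List.∈ ts →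
    ∃[ k ] k < length ts × α 2 (address s k) ≡ label t
  stored-column (t ∷ ts) (entry , stored) (here refl) = length ts , ≤-refl , entry
  stored-column (t ∷ ts) (entry , stored) (there u∈)
    with k , k< , eq ← stored-column ts stored u∈ = k , m≤n⇒m≤1+n k< , eq

  record Rows (α : Arrays) (row : ℕ → List Tool) : Set where
    constructor rows
    field
      stored : ∀ s → Stored α s (row s)
      sizes  : ∀ s → α 4 (+ s) ≡ + length (row s)

  open Rows

  -- Addresses and values are variables with equations because the register expressions of the
  -- machine equal the intended ones only propositionally.
  rows-push : ∀ {α row s t x v y w} → Rows α row → (∀ k → length (row k) ≤ C) → length (row s) < C →
    x ≡ address s (length (row s)) → v ≡ label t → y ≡ + s → w ≡ + suc (length (row s)) →
    Rows (setArr (setArr α 2 x v) 4 y w) (upd row s (t ∷ row s))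
  rows-push {α} {row} {s} {t} R row≤C room refl refl refl refl = rows stored′ sizes′
    where
    x = address s (length (row s))
    α₂ = setArr α 2 x (label t)
    α′ = setArr α₂ 4 (+ s) (+ suc (length (row s)))
    stored′ : ∀ k → Stored α′ k (upd row s (t ∷ row s) k)
    stored′ k = upd-elim row (Stored α′ k)
      (λ { refl → setArr-same {α} {2} {j = x} refl , stored-cong (row s)
             (λ {c} c< → setArr-entry {α} {2} λ eq →
               <⇒≢ c< (address-column {s} {c} {length (row s)} eq)) (stored R s) })
      (λ k≢s → stored-cong (row k)
         (λ {c} c< → setArr-entry {α} {2} λ eq →
           k≢s (address-row {k} {c} {s} {length (row s)} (≤-trans c< (row≤C k)) room eq)) (stored R k))
    sizes′ : ∀ k → α′ 4 (+ k) ≡ + length (upd row s (t ∷ row s) k)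
    sizes′ k = upd-elim row (λ ts → α′ 4 (+ k) ≡ + length ts)
      (λ { refl → setArr-same {α₂} {4} {j = + s} refl })
      (λ k≢s → trans (setArr-entry {α₂} {4} (k≢s ∘ ℤ.+-injective)) (sizes R k))

  record Regs (i p F k : ℕ) (ρ : Reg → ℤ) : Set where
    constructor regs
    field
      r0  : ρ 0 ≡ + n
      r1  : ρ 1 ≡ + C
      r2  : ρ 2 ≡ + 1
      r3  : ρ 3 ≡ + i
      r4  : ρ 4 ≡ + p
      r5  : ρ 5 ≡ + F
      r10 : ρ 10 ≡ + k
      r13 : ρ 13 ≡ + 0

  record Unchanged (α α′ : Arrays) : Set where
    constructor unchanged
    field
      u0 : ∀ j → α′ 0 j ≡ α 0 j
      u1 : ∀ j → α′ 1 j ≡ α 1 j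
      u3 : ∀ j → α′ 3 j ≡ α 3 j
      u5 : ∀ j → α′ 5 j ≡ α 5 j

  unchanged-refl : ∀ {α} → Unchanged α α
  unchanged-refl = unchanged (λ _ → refl) (λ _ → refl) (λ _ → refl) (λ _ → refl)

  push-fits : ∀ {s} t μ → suc (size μ s) < C → full (push s t μ) ≡ full μ
  push-fits {s} t μ fits rewrite dec-true (suc (size μ s) <? C) fits = refl

  push-fills : ∀ {s} t μ → ¬ suc (size μ s) < C → full (push s t μ) ≡ suc s
  push-fills {s} t μ ¬fits rewrite dec-false (suc (size μ s) <? C) ¬fits = refl

  data Pushed (i p k : ℕ) (t : Tool) (μ : Magazine) (α : Arrays) : Config → Set where
    pushed : ∀ {ρ α′} → Regs i p (full μ) k ρ → ρ 6 ≡ label t → ρ 7 ≡ + suc i →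
      Rows α′ (row μ) → Unchanged α α′ → Pushed i p k t μ α (config 24 ρ α′)

  -- A round takes at most 12 steps: the exit test, eight plain instructions, the capacity test, and
  -- two more if the slot fills up. The extra 1 is the last exit test. Register 7 leaves the loop
  -- with `suc i`, the very value to be stored as `nxt`.
  push-loop : ∀ c s {μ i p k t ρ α a} → s + c ≡ suc i → Bounded μ s → Regs i p (full μ) k ρ →
    ρ 6 ≡ label t → ρ 7 ≡ + s → Rows α (row μ) →
    Reaches (config 12 ρ α) a (suc (c * 12 + a)) (Pushed i p k t (pushes c s t μ) α)
  push-loop zero s {i = i} s+c≡ B R r6 r7 rws with trans (sym (+-identityʳ s)) s+c≡
  ... | refl = less-taken refl (Regs.r3 R) r7 ≤-refl (stop (pushed R r6 r7 rws unchanged-refl))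
  push-loop (suc c) s {μ} {i} {p} {k} {t} {ρ} {α} {a} s+c≡ B (regs r0 r1 r2 r3 r4 r5 r10 r13) r6 r7 rws =
    less-skipped refl r3 r7 (≤⇒≯ s≤i) (block 8 refl test)
    where
    open Bounded B
    s≤i : s ≤ i
    s≤i = ≤-pred (≤-trans (m≤m+n (suc s) c) (≤-reflexive (trans (sym (+-suc s c)) s+c≡)))
    size≡ : α 4 (ρ 7) ≡ + size μ s
    size≡ = trans (cong (α 4) r7) (sizes rws s)
    x = (ρ 7 ℤ.* ρ 1 ℤ.+ α 4 (ρ 7)) ℤ.- ρ 1
    α′ = setArr (setArr α 2 x (ρ 6)) 4 (ρ 7) (α 4 (ρ 7) ℤ.+ ρ 2)
    rws′ : Rows α′ (upd (row μ) s (t ∷ row μ s))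
    rws′ = rows-push rws size≤C (roomy full≤)
      (cong₂ ℤ._-_ (cong₂ ℤ._+_ (cong₂ ℤ._*_ r7 r1) size≡) r1) r6 r7 (increment size≡ r2)
    μ′ = push s t μ
    ρ′ : Reg → ℤ
    ρ′ = setReg (setReg (setReg (setReg (setReg (setReg ρ 8 (α 4 (ρ 7))) 9 (ρ 7 ℤ.* ρ 1))
      9 (ρ 7 ℤ.* ρ 1 ℤ.+ α 4 (ρ 7))) 9 x) 8 (α 4 (ρ 7) ℤ.+ ρ 2)) 7 (ρ 7 ℤ.+ ρ 2)
    again : ∀ {ρ″ b} → Regs i p (full μ′) k ρ″ → ρ″ 6 ≡ label t → ρ″ 7 ≡ + suc s → b ≤ 12 + a →
      Reaches (config 12 ρ″ α′) b (suc (suc c * 12 + a)) (Pushed i p k t (pushes (suc c) s t μ) α)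
    again R r6 r7 b≤ = relax b≤ (≤-reflexive (cong suc (arith c a)))
      (push-loop c (suc s) (trans (sym (+-suc s c)) s+c≡) (push-bounded t B) R r6 r7 rws′) ⟫
      -- Writes to arrays 2 and 4 compute away on the other arrays, so the same equations hold
      -- relative to `α`.
      λ { (pushed R r6 r7 rws (unchanged u0 u1 u3 u5)) → stop (pushed R r6 r7 rws (unchanged u0 u1 u3 u5)) }
      where
      arith : ∀ c a → c * 12 + (12 + a) ≡ suc c * 12 + a
      arith = solve-∀
    test : Reaches (config 21 ρ′ α′) (9 + a) (suc (suc c * 12 + a)) (Pushed i p k t (pushes (suc c) s t μ) α)
    test with suc (size μ s) <? C
    ... | yes fits = less-taken refl (increment size≡ r2) r1 fits
      (again (regs r0 r1 r2 r3 r4 (trans r5 (cong +_ (sym (push-fits t μ fits)))) r10 r13)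
        r6 (increment r7 r2) (+-monoˡ-≤ a (m≤m+n 10 2)))
    ... | no ¬fits = less-skipped refl (increment size≡ r2) r1 ¬fits (block 2 refl
      (again (regs r0 r1 r2 r3 r4 (trans (increment r7 r2) (cong +_ (sym (push-fills t μ ¬fits)))) r10 r13)
        r6 (increment r7 r2) ≤-refl))

  rows-cong : ∀ {α α′ row} → (∀ j → α′ 2 j ≡ α 2 j) → (∀ j → α′ 4 j ≡ α 4 j) → Rows α row → Rows α′ row
  rows-cong {row = row} α′₂ α′₄ R =
    rows (λ s → stored-cong (row s) (λ _ → α′₂ _) (stored R s)) (λ s → trans (α′₄ _) (sizes R s))

  Entries : Arr → Arrays → (Tool → ℕ) → Set
  Entries a α f = ∀ t → α a (label t) ≡ + f t

  entries-set : ∀ {a α f t v x y} → Entries a α f → x ≡ label t → y ≡ + v →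
    Entries a (setArr α a x y) (Tools.upd f t v)
  entries-set {a} {α} {f} {t} {v} E refl refl u = Tools.upd-elim f
    (λ w → setArr α a (label t) (+ v) a (label u) ≡ + w)
    (λ { refl → setArr-same {α} {a} {j = label t} refl })
    (λ u≢t → trans (setArr-entry {α} {a} (u≢t ∘ label-injective)) (E u))

  record Loaded (js : List (List Tool)) (i p : ℕ) (ts : List Tool) (st : State) (α : Arrays) : Set where
    constructor loaded
    field
      lengths : ∀ k → α 0 (+ (k + i)) ≡ contents (map (λ ts → + length ts) js) (+ k)
      input   : ∀ k → α 1 (+ (k + p)) ≡ contents (map label (ts ++ concat js)) (+ k)
      rws     : Rows α (State.slots st)
      nexts   : Entries 3 α (nxt st)
      marks   : Entries 5 α (λ _ → 0)

  -- Twelve steps per stored entry: a long pipe is paid for by the growth of the rows rather than by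
  -- its job.
  potential : State → ℕ
  potential st = total (size (magazine st)) (suc n) * 12

  data AtJob (js : List (List Tool)) (i : ℕ) (st : State) : Config → Set where
    atJob : ∀ {p k ρ α} → Regs i p (State.barrier st) k ρ → Loaded js i p [] st α →
      AtJob js i st (config 1 ρ α)

  use-reject : ∀ i t st → nxt st t < State.barrier st →
    use i t st ≡ advance i i (upd (rejected st) i (t ∷ rejected st i)) t st
  use-reject i t st nxt<F rewrite dec-true (nxt st t <? State.barrier st) nxt<F = refl

  use-accept : ∀ i t st → ¬ nxt st t < State.barrier st →
    use i t st ≡ advance i (nxt st t) (rejected st) t st
  use-accept i t st nxt≮F rewrite dec-false (nxt st t <? State.barrier st) nxt≮F = refl

  -- Besides its pushes a tool costs 10 steps on either branch: seven before the push loop, the exit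
  -- test of that loop, and two after it.
  tool-loop : ∀ ts {h js p st ρ α a} → let i = suc h in i ≤ n → Invariant i ts st →
    Regs i p (State.barrier st) (length ts) ρ → Loaded js i p ts st α →
    Reaches (config 4 ρ α) (a + potential st) (length ts * 10 + 1 + a + potential (uses i ts st))
      (AtJob js i (uses i ts st))
  tool-loop []       i≤n inv R Ld = equal-taken refl (Regs.r10 R) (Regs.r13 R) refl (stop (atJob R Ld))
  tool-loop (t ∷ ts) {h} {js} {p} {st} {ρ} {α} {a} i≤n inv (regs r0 r1 r2 r3 r4 r5 r10 r13)
    (loaded lengths input rws nexts marks) =
    equal-skipped refl r10 r13 (λ ()) (block 4 refl choose)
    where
    i = suc h
    F = State.barrier st
    Q = AtJob js i (uses i (t ∷ ts) st)
    end = length (t ∷ ts) * 10 + 1 + a + potential (uses i (t ∷ ts) st)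
    open Invariant inv using (bounded; todo-roomy; todo-fresh)

    r6′ : α 1 (ρ 4) ≡ label t
    r6′ = trans (cong (α 1) r4) (input 0)

    r7′ : α 3 (α 1 (ρ 4)) ≡ + nxt st t
    r7′ = trans (cong (α 3) r6′) (nexts t)

    arith₁ : ∀ c a x → 2 + suc (c * 12 + (7 + (a + x * 12))) ≡ 10 + a + (c + x) * 12
    arith₁ = solve-∀

    arith₂ : ∀ l a x → l * 10 + 1 + (10 + a) + x ≡ 10 + l * 10 + 1 + a + x
    arith₂ = solve-∀

    proceed : ∀ {ρ′} s X → use i t st ≡ advance i s X t st → s ≤ i → F ≤ s →
      Regs i (suc p) F (length ts) ρ′ → ρ′ 6 ≡ label t → ρ′ 7 ≡ + s →
      Reaches (config 12 ρ′ α) (7 + (a + potential st)) end Q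
    proceed s X use≡ s≤i F≤s R r6 r7 =
      push-loop (suc i ∸ s) s s+c≡ (record { Bounded bounded ; full≤ = F≤s }) R r6 r7 rws ⟫
      λ { (pushed {ρ″} {α″} R r6 r7 rws (unchanged u0 u1 u3 u5)) →
        block 2 refl (relax
          (≤-reflexive (trans (arith₁ (suc i ∸ s) a _)
            (cong (λ x → 10 + a + x * 12) (sym
              (total-pushes (suc i ∸ s) s t (magazine st) (suc n) (≤-trans (≤-reflexive s+c≡) (s≤s i≤n)))))))
          (≤-reflexive (arith₂ (length ts) a _))
          (subst (λ st′ → Reaches _ (10 + a + potential (advance i s X t st))
              (length ts * 10 + 1 + (10 + a) + potential (uses i ts st′)) (AtJob js i (uses i ts st′)))
            (sym use≡)
            (tool-loop ts i≤n (subst (Invariant i ts) use≡ (use-invariant inv))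
              (regs (Regs.r0 R) (Regs.r1 R) (Regs.r2 R) (Regs.r3 R) (Regs.r4 R) (Regs.r5 R) (Regs.r10 R) (Regs.r13 R))
              (loaded
                (λ k → trans (u0 _) (lengths k))
                (λ k → trans (u1 _) (trans (cong (λ x → α 1 (+ x)) (+-suc k p)) (input (suc k))))
                (rows-cong (λ _ → refl) (λ _ → refl) rws)
                (entries-set {3} {α″} (λ u → trans (u3 _) (nexts u)) r6 r7)
                (λ u → trans (u5 _) (marks u)))))) }
      where
      s+c≡ : s + (suc i ∸ s) ≡ suc i
      s+c≡ = m+[n∸m]≡n (m≤n⇒m≤1+n s≤i)

    choose : Reaches _ (5 + (a + potential st)) end Q
    choose with nxt st t <? F
    ... | yes nxt<F = less-taken refl r7′ r5 nxt<F (block 1 refl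
      (proceed i _ (use-reject i t st nxt<F) ≤-refl (todo-roomy (s≤s z≤n))
        (regs r0 r1 r2 r3 (increment r4 r2) r5 (decrement r10 r2) r13) r6′ r3))
    ... | no  nxt≮F = less-skipped refl r7′ r5 nxt≮F (block 1 refl
      (proceed (nxt st t) _ (use-accept i t st nxt≮F) (todo-fresh (here refl)) (≮⇒≥ nxt≮F)
        (regs r0 r1 r2 r3 (increment r4 r2) r5 (decrement r10 r2) r13) r6′ r7′))

  data AtFilling (st : State) : Config → Set where
    atFilling : ∀ {i p F k ρ α} → Regs i p F k ρ → Rows α (State.slots st) → Entries 5 α (λ _ → 0) →
      AtFilling st (config 26 ρ α)

  -- The 4 counts the head test, two plain instructions and the exit test of the tool loop.
  job-loop : ∀ js {i st σ a} → length js + i ≡ n → (∀ k → nth js k ≡ need (suc (k + i))) →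
    Invariant i [] st → AtJob js i st σ →
    Reaches σ (a + potential st) (length js * (C * 10 + 4) + 1 + a + potential (jobs i js st))
      (AtFilling (jobs i js st))
  job-loop []        i≡n _ _ (atJob R (loaded _ _ rws _ marks)) =
    equal-taken refl (Regs.r3 R) (Regs.r0 R) i≡n (stop (atFilling R rws marks))
  job-loop (ts ∷ js) {i} {st} {a = a} js+i≡n js≡ inv (atJob {α = α} (regs r0 r1 r2 r3 r4 r5 r10 r13)
    (loaded lengths input rws nexts marks)) =
    equal-skipped refl r3 r0 (<⇒≢ i<n) (block 2 refl
      (tool-loop ts {a = 3 + a} i<n inv′
        (regs r0 r1 r2 (increment r3 r2) r4 r5 (trans (cong (α 0) r3) (lengths 0)) r13)
        (loaded (λ k → trans (cong (λ x → α 0 (+ x)) (+-suc k i)) (lengths (suc k))) input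
          (rows-cong (λ _ → refl) (λ _ → refl) rws) nexts marks))
      ⟫ λ at → relax
        (+-monoˡ-≤ (potential st′) (≤-trans (≤-reflexive (arith₁ (length ts) a))
          (+-monoˡ-≤ a (+-monoˡ-≤ 4 (*-monoˡ-≤ 10 ts≤C)))))
        (≤-reflexive (arith₂ (length js) (C * 10 + 4) a _))
        (job-loop js (trans (+-suc (length js) i) js+i≡n)
          (λ k → trans (js≡ (suc k)) (cong (need ∘ suc) (sym (+-suc k i))))
          (uses-invariant ts inv′) at))
    where
    st′ = uses (suc i) ts st
    i<n : i < n
    i<n = ≤-trans (s≤s (m≤n+m i (length js))) (≤-reflexive js+i≡n)
    ts≤C : length ts ≤ C
    ts≤C = subst (λ xs → length xs ≤ C) (sym (js≡ 0)) (need≤C (suc i))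
    inv′ : Invariant (suc i) ts st
    inv′ = subst (λ xs → Invariant (suc i) xs st) (sym (js≡ 0))
      (next-invariant (need-unique (suc i)) (need≤C (suc i)) inv)
    arith₁ : ∀ l a → l * 10 + 1 + (3 + a) ≡ l * 10 + 4 + a
    arith₁ = solve-∀
    arith₂ : ∀ l b a x → l * b + 1 + (b + a) + x ≡ suc l * b + 1 + a + x
    arith₂ = solve-∀

  record FillRegs (s l k : ℕ) (ρ : Reg → ℤ) : Set where
    constructor fillRegs
    field
      r0  : ρ 0 ≡ + n
      r1  : ρ 1 ≡ + C
      r2  : ρ 2 ≡ + 1
      r3  : ρ 3 ≡ + s
      r7  : ρ 7 ≡ + suc s
      r8  : ρ 8 ≡ + l
      r10 : ρ 10 ≡ + k
      r13 : ρ 13 ≡ + 0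

  mark : ℕ → List Tool → (Tool → ℕ) → Tool → ℕ
  mark s []       f = f
  mark s (t ∷ ts) f = mark s ts (Tools.upd f t s)

  mark-cases : ∀ s ts f t → t List.∈ ts × mark s ts f t ≡ s ⊎ t List.∉ ts × mark s ts f t ≡ f t
  mark-cases s []       f t = inj₂ ((λ ()) , refl)
  mark-cases s (x ∷ ts) f t with mark-cases s ts (Tools.upd f x s) t
  ... | inj₁ (t∈ts , eq) = inj₁ (there t∈ts , eq)
  ... | inj₂ (t∉ts , eq) with t Fin.≟ x
  ...   | yes refl = inj₁ (here refl , eq)
  ...   | no  t≢x  = inj₂ ((λ { (here t≡x) → t≢x t≡x ; (there t∈ts) → t∉ts t∈ts }) ,
                           eq)

  data Marked (s l : ℕ) (row : ℕ → List Tool) (f : Tool → ℕ) : Config → Set where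
    marked : ∀ {k ρ α} → FillRegs s l k ρ → Rows α row → Entries 5 α f → Marked s l row f (config 39 ρ α)

  -- Counting columns downwards visits the row from the head of its list, as the recursion does.
  mark-loop : ∀ ts {s l f row ρ α a} → FillRegs s l (length ts) ρ → Stored α (suc s) ts →
    Rows α row → Entries 5 α f →
    Reaches (config 31 ρ α) a (length ts * 8 + 1 + a) (Marked s l row (mark (suc s) ts f))
  mark-loop [] R _ rws marks =
    equal-taken refl (FillRegs.r10 R) (FillRegs.r13 R) refl (stop (marked R rws marks))
  mark-loop (t ∷ ts) {α = α} {a = a} (fillRegs r0 r1 r2 r3 r7 r8 r10 r13) (entry , entries) rws marks =
    equal-skipped refl r10 r13 (λ ()) (block 7 refl (relax ≤-refl (≤-reflexive (arith (length ts) a))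
      (mark-loop ts (fillRegs r0 r1 r2 r3 r7 r8 (decrement r10 r2) r13)
        (stored-cong ts (λ _ → refl) entries)
        (rows-cong (λ _ → refl) (λ _ → refl) rws)
        (entries-set {5} {α} marks
          (trans (cong (α 2) (cong₂ ℤ._-_ (cong₂ ℤ._+_ (cong₂ ℤ._*_ r7 r1) (decrement r10 r2)) r1)) entry)
          r7))))
    where
    arith : ∀ l a → l * 8 + 1 + (8 + a) ≡ 8 + l * 8 + 1 + a
    arith = solve-∀

  insert-full : ∀ t {cur} → length cur ≡ C → insert t cur ≡ cur
  insert-full t {cur} full rewrite dec-true (length cur ≟ C) full = refl

  insert-present : ∀ {t cur} → length cur ≢ C → t List.∈ cur → insert t cur ≡ cur
  insert-present {t} {cur} room t∈cur
    rewrite dec-false (length cur ≟ C) room | dec-true (t ∈? cur) t∈cur = refl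

  insert-new : ∀ {t cur} → length cur ≢ C → t List.∉ cur → insert t cur ≡ t ∷ cur
  insert-new {t} {cur} room t∉cur
    rewrite dec-false (length cur ≟ C) room | dec-false (t ∈? cur) t∉cur = refl

  -- `bound` is what spares clearing the array between rows: old marks, including the initial 0, are
  -- smaller than the next slot number and cannot be mistaken for current ones.
  record Marks (s : ℕ) (cur : List Tool) (f : Tool → ℕ) : Set where
    constructor marks
    field
      complete : ∀ {t} → t List.∈ cur → f t ≡ s
      sound    : ∀ {t} → f t ≡ s → t List.∈ cur
      bound    : ∀ t → f t ≤ s

  marks-new : ∀ {s cur f} t → Marks s cur f → Marks s (t ∷ cur) (Tools.upd f t s)
  marks-new {s} {cur} {f} t (marks complete sound bound) = marks
    (λ {u} u∈ → Tools.upd-elim f (_≡ s) (λ _ → refl)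
      (λ u≢t → complete (in-tail u≢t u∈)))
    (λ {u} → Tools.upd-elim f (λ x → x ≡ s → u List.∈ t ∷ cur)
      (λ u≡t _ → here u≡t) (λ _ eq → there (sound eq)))
    (λ u → Tools.upd-elim f (_≤ s) (λ _ → ≤-refl) (λ _ → bound u))
    where
    in-tail : ∀ {u} → u ≢ t → u List.∈ t ∷ cur → u List.∈ cur
    in-tail u≢t (here u≡t) = contradiction u≡t u≢t
    in-tail u≢t (there u∈) = u∈

  data RowFilled (s : ℕ) (row : ℕ → List Tool) (res : List Tool) : Config → Set where
    rowFilled : ∀ {l k ρ α row′ f} → FillRegs s l k ρ → Rows α row′ → row′ (suc s) ≡ res →
      (∀ {k} → k ≢ suc s → row′ k ≡ row k) → Entries 5 α f → (∀ t → f t ≤ suc s) →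
      RowFilled s row res (config 57 ρ α)

  -- Seventeen steps is the longest round, in which a tool is inserted; the two ways of skipping a
  -- tool are shorter and are padded.
  fill-loop : ∀ ts {s row f ρ α a} → FillRegs s (length (row (suc s))) (length ts) ρ →
    Stored α s ts → length ts ≤ C → (∀ k → length (row k) ≤ C) → Rows α row →
    Entries 5 α f → Marks (suc s) (row (suc s)) f →
    Reaches (config 40 ρ α) a (length ts * 17 + 1 + a) (RowFilled s row (fillFrom ts (row (suc s))))
  fill-loop [] R _ _ _ rws entries (marks _ _ bound) =
    equal-taken refl (FillRegs.r10 R) (FillRegs.r13 R) refl
      (stop (rowFilled R rws refl (λ _ → refl) entries bound))
  fill-loop (t ∷ ts) {s} {row} {f} {ρ} {α} {a} (fillRegs r0 r1 r2 r3 r7 r8 r10 r13)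
    (entry , stored-ts) ts≤C row≤C rws entries M@(marks complete sound bound) =
    equal-skipped refl r10 r13 (λ ()) (block 1 refl (check-full (length cur ≟ C)))
    where
    cur = row (suc s)
    Q = RowFilled s row (fillFrom ts (insert t cur))
    end = length (t ∷ ts) * 17 + 1 + a

    arith : ∀ l a → l * 17 + 1 + (17 + a) ≡ 17 + l * 17 + 1 + a
    arith = solve-∀

    skip : ∀ {ρ′ b} → b ≤ 17 + a → FillRegs s (length cur) (length ts) ρ′ → insert t cur ≡ cur →
      Reaches (config 40 ρ′ α) b end Q
    skip b≤ R insert≡ = relax b≤ (≤-reflexive (arith (length ts) a))
      (subst (λ xs → Reaches _ _ _ (RowFilled s row (fillFrom ts xs))) (sym insert≡)
        (fill-loop ts R stored-ts (≤-trans (n≤1+n _) ts≤C) row≤C rws entries M))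

    x = (ρ 3 ℤ.* ρ 1 ℤ.+ (ρ 10 ℤ.- ρ 2)) ℤ.- ρ 1

    r6 : α 2 x ≡ label t
    r6 = trans (cong (α 2) (cong₂ ℤ._-_ (cong₂ ℤ._+_ (cong₂ ℤ._*_ r3 r1) (decrement r10 r2)) r1)) entry

    r12 : α 5 (α 2 x) ≡ + f t
    r12 = trans (cong (α 5) r6) (entries t)

    check-mark : length cur ≢ C → ∀ {ρ′} → ρ′ 12 ≡ + f t → ρ′ 6 ≡ label t →
      FillRegs s (length cur) (length ts) ρ′ → f t ≡ suc s ⊎ f t ≢ suc s →
      Reaches (config 48 ρ′ α) (8 + a) end Q
    check-mark room r12 r6 R (inj₁ eq) = equal-taken refl r12 (FillRegs.r7 R) eq
      (skip (+-monoˡ-≤ a (m≤m+n 9 8)) R (insert-present room (sound eq)))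
    check-mark room {ρ′} r12 r6 (fillRegs r0 r1 r2 r3 r7 r8 r10 r13) (inj₂ neq) =
      equal-skipped refl r12 r7 neq (block 8 refl
        (relax ≤-refl (≤-reflexive (arith (length ts) a))
          (fill-loop ts {row = row′}
            (fillRegs r0 r1 r2 r3 r7 (trans (increment r8 r2) (cong (λ xs → + length xs) (sym row′≡))) r10 r13)
            -- The insertion goes to row `suc s`, so the source row `s` survives while it is being
            -- read.
            (stored-cong ts (λ {k} k< → setArr-entry {setArr α 5 (ρ′ 6) (ρ′ 7)} {2} λ eq → m≢1+m+n s (trans
                (address-row {s} {k} {suc s} {length cur} (≤-trans (m≤n⇒m≤1+n k<) ts≤C) cur<C
                  (trans eq address≡)) (cong suc (sym (+-identityʳ s)))))
              stored-ts)
            (≤-trans (n≤1+n _) ts≤C)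
            (λ k → upd-elim row (λ xs → length xs ≤ C) (λ _ → cur<C) (λ _ → row≤C k))
            (rows-push (rows-cong (λ _ → refl) (λ _ → refl) rws) row≤C cur<C address≡ r6 r7 (increment r8 r2))
            (entries-set {5} {α} entries r6 r7)
            (subst (λ xs → Marks (suc s) xs (Tools.upd f t (suc s))) (sym row′≡) (marks-new t M)))
        ⟫ λ { (rowFilled R rws res≡ others entries bound) → stop (rowFilled R rws
            (trans res≡ (cong (fillFrom ts) (trans row′≡ (sym (insert-new room (neq ∘ complete))))))
            (λ k≢ → trans (others k≢) (upd-other row k≢)) entries bound) }))
      where
      row′ = upd row (suc s) (t ∷ cur)
      row′≡ : row′ (suc s) ≡ t ∷ cur
      row′≡ = upd-same row (suc s)
      cur<C : length cur < C
      cur<C = ≤∧≢⇒< (row≤C (suc s)) room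
      address≡ = cong₂ ℤ._-_ (cong₂ ℤ._+_ (cong₂ ℤ._*_ r7 r1) r8) r1

    decide : f t ≡ suc s ⊎ f t ≢ suc s
    decide with f t ≟ suc s
    ... | yes eq = inj₁ eq
    ... | no neq = inj₂ neq

    check-full : Dec (length cur ≡ C) → Reaches _ (2 + a) end Q
    check-full (yes full) = equal-taken refl r8 r1 full
      (skip (+-monoˡ-≤ a (m≤m+n 3 14)) (fillRegs r0 r1 r2 r3 r7 r8 (decrement r10 r2) r13) (insert-full t full))
    check-full (no room) = equal-skipped refl r8 r1 room (block 5 refl
      (check-mark room r12 r6 (fillRegs r0 r1 r2 r3 r7 r8 (decrement r10 r2) r13) decide))

  open Invariant σ*-invariant using (bounded; row-unique)
  open State σ* using (slots)

  data AtRow (s : ℕ) : Config → Set where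
    atRow : ∀ {ρ α row f} → ρ 0 ≡ + n → ρ 1 ≡ + C → ρ 2 ≡ + 1 → ρ 3 ≡ + s → ρ 13 ≡ + 0 →
      Rows α row → (∀ {k} → k ≤ s → row k ≡ result k) → (∀ {k} → s < k → row k ≡ slots k) →
      Entries 5 α f → (∀ t → f t ≤ s) → AtRow s (config 27 ρ α)

  data Finished : Config → Set where
    finished : ∀ {ρ α row} → Rows α row → (∀ {k} → k ≤ n → row k ≡ result k) → Finished (config 59 ρ α)

  -- Per row, 25 is 8 for marking plus 17 for filling each column, and 9 collects the tests and
  -- instructions outside the inner rounds.
  row-loop : ∀ d {s σ a} → d + s ≡ n → AtRow s σ → Reaches σ a (d * (C * 25 + 9) + 1 + a) Finished
  row-loop zero    refl (atRow r0 _ _ r3 _ rws done _ _ _) =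
    equal-taken refl r3 r0 refl (stop (finished rws done))
  row-loop (suc d) {s} {a = a} d+s≡n
    (atRow {ρ} {α} {row} {f} r0 r1 r2 r3 r13 rws done todo entries bound) =
    equal-skipped refl r3 r0 (<⇒≢ s<n) (block 3 refl
      (mark-loop (row (suc s))
        (fillRegs r0 r1 r2 r3 (increment r3 r2) size≡ size≡ r13)
        (stored rws (suc s)) rws entries
      ⟫ λ { (marked (fillRegs r0 r1 r2 r3 r7 r8 r10 r13) rws entries) → block 1 refl
        (fill-loop (row s)
          (fillRegs r0 r1 r2 r3 r7 r8 (trans r1 (cong +_ (sym size-s))) r13)
          (stored rws s) (≤-reflexive size-s) row≤C rws entries marks′
      ⟫ λ { (rowFilled {row′ = row′} (fillRegs r0 r1 r2 r3 r7 r8 r10 r13) rws new others entries bound) → block 2 refl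
        (relax clock (≤-reflexive (arith₂ d (C * 25 + 9) a))
          (row-loop d (trans (+-suc d s) d+s≡n) (atRow r0 r1 r2 r7 r13 rws
            (done′ row′ new others)
            (λ 1+s<k → trans (others (>⇒≢ 1+s<k)) (todo (<⇒≤ 1+s<k)))
            entries bound))) }) }))
    where
    s<n : s < n
    s<n = ≤-trans (s≤s (m≤n+m s d)) (≤-reflexive d+s≡n)

    size≡ : α 4 (ρ 3 ℤ.+ ρ 2) ≡ + length (row (suc s))
    size≡ = trans (cong (α 4) (increment r3 r2)) (sizes rws (suc s))

    size-s : length (row s) ≡ C
    size-s = trans (cong length (done ≤-refl)) (result-length s)

    row≤C : ∀ k → length (row k) ≤ C
    row≤C k with k ≤? s
    ... | yes k≤s = ≤-reflexive (trans (cong length (done k≤s)) (result-length k))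
    ... | no  k≰s = subst (λ xs → length xs ≤ C) (sym (todo (≰⇒> k≰s))) (Bounded.size≤C bounded k)

    marks′ : Marks (suc s) (row (suc s)) (mark (suc s) (row (suc s)) f)
    marks′ = marks complete sound bound′
      where
      complete : ∀ {t} → t List.∈ row (suc s) → mark (suc s) (row (suc s)) f t ≡ suc s
      complete {t} t∈ with mark-cases (suc s) (row (suc s)) f t
      ... | inj₁ (_ , eq) = eq
      ... | inj₂ (t∉ , _) = contradiction t∈ t∉
      sound : ∀ {t} → mark (suc s) (row (suc s)) f t ≡ suc s → t List.∈ row (suc s)
      sound {t} eq with mark-cases (suc s) (row (suc s)) f t
      ... | inj₁ (t∈ , _) = t∈
      ... | inj₂ (_ , old) = contradiction (trans (sym old) eq) (<⇒≢ (s≤s (bound t)))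
      bound′ : ∀ t → mark (suc s) (row (suc s)) f t ≤ suc s
      bound′ t with mark-cases (suc s) (row (suc s)) f t
      ... | inj₁ (_ , eq)  = ≤-reflexive eq
      ... | inj₂ (_ , old) = ≤-trans (≤-reflexive old) (m≤n⇒m≤1+n (bound t))

    done′ : ∀ row′ → row′ (suc s) ≡ fillFrom (row s) (row (suc s)) →
      (∀ {k} → k ≢ suc s → row′ k ≡ row k) → ∀ {k} → k ≤ suc s → row′ k ≡ result k
    done′ row′ new others k≤1+s with m≤n⇒m<n∨m≡n k≤1+s
    ... | inj₁ (s≤s k≤s) = trans (others (<⇒≢ (s≤s k≤s))) (done k≤s)
    ... | inj₂ refl      = trans new (cong₂ fillFrom (done ≤-refl) (todo ≤-refl))

    arith₁ : ∀ C a → 2 + (C * 17 + 1 + (1 + (C * 8 + 1 + (4 + a)))) ≡ C * 25 + 9 + a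
    arith₁ = solve-∀
    arith₂ : ∀ d b a → d * b + 1 + (b + a) ≡ suc d * b + 1 + a
    arith₂ = solve-∀

    clock : 2 + (length (row s) * 17 + 1 + (1 + (length (row (suc s)) * 8 + 1 + (4 + a)))) ≤ C * 25 + 9 + a
    clock = ≤-trans
      (+-monoʳ-≤ 2 (+-mono-≤ (+-monoˡ-≤ 1 (*-monoˡ-≤ 17 (≤-reflexive size-s)))
        (+-monoʳ-≤ 1 (+-monoˡ-≤ (4 + a) (+-monoˡ-≤ 1 (*-monoˡ-≤ 8 (row≤C (suc s))))))))
      (≤-reflexive (arith₁ C a))

  finished-outputs : ∀ {σ} → Finished σ → Outputs I σ loading
  finished-outputs (finished {α = α} {row} rws done) i = outputs , covered
    where
    s = suc (toℕ i)
    row≡ : row s ≡ result s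
    row≡ = done (Fin.toℕ<n i)
    size≡ : length (row s) ≡ C
    size≡ = trans (cong length row≡) (result-length s)
    outputs : ∀ (j : Fin C) → ∃[ t ] t Subset.∈ loading i × α 2 (+ (toℕ i * C + toℕ j)) ≡ label t
    outputs j with t , t∈ , eq ← stored-entry (row s) (stored rws s)
                                   (≤-trans (Fin.toℕ<n j) (≤-reflexive (sym size≡))) =
      t , ∈-fromList⁺ (subst (t List.∈_) row≡ t∈) ,
      trans (cong (α 2) (sym (address-suc (toℕ i) (toℕ j)))) eq
    covered : ∀ t → t Subset.∈ loading i → ∃[ j ] α 2 (+ (toℕ i * C + toℕ {C} j)) ≡ label t
    covered t t∈ with k , k< , eq ← stored-column (row s) (stored rws s)
                                     (subst (t List.∈_) (sym row≡) (∈-fromList⁻ _ t∈)) =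
      Fin.fromℕ< k<C , trans (cong (α 2) (trans
        (cong (λ c → + (toℕ i * C + c)) (Fin.toℕ-fromℕ< k<C)) (sym (address-suc (toℕ i) k)))) eq
      where
      k<C : k < C
      k<C = ≤-trans k< (≤-reflexive size≡)

  0<n : 0 < n
  0<n = ≤-trans (s≤s z≤n) (Fin.toℕ<n (proj₁ (covers (Fin.fromℕ< C<m))))

  -- The coefficient of `C * n` is 47 = 25 + 10 + 12 from filling, tools and pushes; 13 = 9 + 4 per
  -- job, 12 per entry of slot 0 and 4 single steps are absorbed by `n`, `C` and 1 being at most
  -- `C * n`, and 47 + 13 + 12 + 4 = 76.
  program-run : Reaches (initial L) 0 (76 * (C * n)) Finished
  program-run = block 1 refl (relax (s≤s z≤n) ≤-refl (job-loop (tabulate tools) {a = 1}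
      (trans (+-identityʳ _) (length-tabulate tools))
      (λ k → trans (nth-tabulate tools k) (cong (need ∘ suc) (sym (+-identityʳ k))))
      (start-invariant positive refl)
      (atJob (regs refl refl refl refl refl refl refl refl)
        (loaded
          (λ k → cong₂ contents (sym (map-tabulate tools (λ ts → + length ts))) (cong +_ (+-identityʳ k)))
          (λ k → cong (contents (map label (concat (tabulate tools)))) (cong +_ (+-identityʳ k)))
          (rows (λ _ → tt) (λ _ → refl)) (λ _ → refl) (λ _ → refl))))
    ⟫ λ { (atFilling R rws entries) → block 1 refl (relax ≤-refl clock
        (row-loop n (+-identityʳ n) (atRow (Regs.r0 R) (Regs.r1 R) (Regs.r2 R) refl (Regs.r13 R) rws
          (λ { z≤n → refl }) (λ _ → refl) entries (λ _ → z≤n)))) })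
    where
    arith : ∀ C n → n * (C * 25 + 9) + 1 + (1 + (n * (C * 10 + 4) + 1 + 1 + suc n * C * 12)) ≡
      47 * (C * n) + (13 * n + (12 * C + 4))
    arith = solve-∀
    total-arith : ∀ x → 47 * x + (13 * x + (12 * x + 4 * x)) ≡ 76 * x
    total-arith = solve-∀
    C≤Cn : C ≤ C * n
    C≤Cn = ≤-trans (≤-reflexive (sym (*-identityʳ C))) (*-monoʳ-≤ C 0<n)
    n≤Cn : n ≤ C * n
    n≤Cn = ≤-trans (≤-reflexive (sym (*-identityˡ n))) (*-monoˡ-≤ n positive)
    clock : n * (C * 25 + 9) + 1 +
        (1 + (length (tabulate tools) * (C * 10 + 4) + 1 + 1 + potential σ*)) ≤ 76 * (C * n)
    clock = begin
      n * (C * 25 + 9) + 1 + (1 + (length (tabulate tools) * (C * 10 + 4) + 1 + 1 + potential σ*))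
        ≤⟨ +-monoʳ-≤ (n * (C * 25 + 9) + 1) (s≤s (+-mono-≤
             (≤-reflexive (cong (λ l → l * (C * 10 + 4) + 1 + 1) (length-tabulate tools)))
             (*-monoˡ-≤ 12 (total≤ (suc n) (Bounded.size≤C bounded))))) ⟩
      n * (C * 25 + 9) + 1 + (1 + (n * (C * 10 + 4) + 1 + 1 + suc n * C * 12))  ≡⟨ arith C n ⟩
      47 * (C * n) + (13 * n + (12 * C + 4))
        ≤⟨ +-monoʳ-≤ (47 * (C * n)) (+-mono-≤ (*-monoʳ-≤ 13 n≤Cn)
             (+-mono-≤ (*-monoʳ-≤ 12 C≤Cn) (*-monoʳ-≤ 4 (≤-trans positive C≤Cn)))) ⟩
      47 * (C * n) + (13 * (C * n) + (12 * (C * n) + 4 * (C * n)))  ≡⟨ total-arith (C * n) ⟩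
      76 * (C * n)  ∎
      where open ≤-Reasoning

theorem3 : ∃[ P ] ∃[ K ] ((I : Instance) (L : Listing I) →
    ∃[ k ] ∃[ σ ] ∃[ M ]
    ( P ⊢ initial L ⇓[ k ] σ
    × k ≤ K * (Instance.C I * Instance.n I)
    × Outputs I σ M
    × Optimal I M ))
theorem3 = program , 76 , solve
  where
  solve : (I : Instance) (L : Listing I) → ∃[ k ] ∃[ σ ] ∃[ M ]
    ( program ⊢ initial L ⇓[ k ] σ
    × k ≤ 76 * (Instance.C I * Instance.n I)
    × Outputs I σ M
    × Optimal I M )
  solve I L with Simulation.program-run I L
  -- Matching on `finished` reveals the program counter 59, one past the last instruction, where the
  -- halting condition holds by `refl`.
  ... | reaches {k} clock run done@(Simulation.finished _ _) =
    k , _ , loading , iterate-⇓ k run refl ,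
    ≤-trans (≤-reflexive (sym (+-identityʳ k))) clock , finished-outputs done , loading-optimal
    where
    open Optimality I L using (loading; loading-optimal)
    open Simulation I L using (finished-outputs)
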